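{- Let $\tau$ be a relational signature (possibly with constants) and let $T$ be a complete pp-$\tau$-theory. The following are equivalent: (i) $T$ has a model that is finite or $\omega$-categorical; (ii) for each $n\ge 0$, the equivalence relation $\sim^T_n$ has finite index; (iii) for each $n \ge 0$, $T$ has only finitely many maximal pp-$n$-types.
   Context: A primitive positive (pp) formula is one built from atomic formulas (including equalities $x=y$ and the constant false $\bot$) using only conjunction and existential quantification. A complete pp-$\tau$-theory is a satisfiable set $T$ of pp-$\tau$-sentences and negations of pp-$\tau$-sentences such that for every pp-$\tau$-sentence $\phi$, either $\phi\in T$ or $\neg\phi\in T$. A pp-$n$-type of $T$ is a set $p(x_1,\dots,x_n)$ of pp-formulas with free variables among $x_1,\dots,x_n$ such that $p\cup T$ is satisfiable; it is maximal if for every pp-formula $\phi(x_1,\dots,x_n)\notin T\cup p$, the set $T\cup p\cup\{\phi\}$ is unsatisfiable. For pp-formulas $\phi_1,\phi_2$ with free variables $x_1,\dots,x_n$, set $\phi_1\sim^T_n\phi_2$ iff for every pp-formula $\psi$ with free variables $x_1,\dots,x_n$, $\{\phi_1,\psi\}\cup T$ is satisfiable if and only if $\{\phi_2,\psi\}\cup T$ is satisfiable. A structure is $\omega$-categorical if it is countably infinite and is the unique countable model of its first-order theory up to isomorphism.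
   Formalization: The signature is assumed countable (without this, ω with all finitary relations satisfies (i) but not (ii)), and maximal pp-n-types p, q are counted as equal when T ∪ p = T ∪ q, since otherwise sentences of T may be freely added or dropped. -}

module Defs where

open import Data.Empty using (⊥)
open import Data.Fin using (Fin; zero; suc; _↑ˡ_)
open import Data.List using (List)
import Data.List.Relation.Unary.Enumerates.Setoid as Enumerates
open import Data.Nat using (ℕ; zero; suc; _+_)
open import Data.Product using (Σ; ∃; ∃-syntax; _×_; _,_; proj₁)
open import Data.Sum using (_⊎_)
open import Data.Vec using (Vec; []; _∷_; lookup; map)
open import Function.Bundles using (_↔_; _↣_; _⇔_; Inverse)
open import Function.Properties.Equivalence using (⇔-isEquivalence)
open import Level using (Level; 0ℓ; _⊔_) renaming (suc to lsuc)
open import Relation.Binary.Bundles using (Setoid)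
open import Relation.Binary.PropositionalEquality using (_≡_)
open import Relation.Binary.Structures using (IsEquivalence)
open import Relation.Nullary using (¬_)
open import Relation.Unary using (Pred; _∈_; _∉_; _⊆_; _∪_; ｛_｝; _≐_)
open import Relation.Unary.Properties using (≐-refl; ≐-sym; ≐-trans)

Countable : Set → Set
Countable A = A ↣ ℕ

CountablyInfinite : Set → Set
CountablyInfinite A = ℕ ↔ A

Finite : Set → Set
Finite A = ∃[ n ] (Fin n ↔ A)

FinitelyMany : {a ℓ : Level} → Setoid a ℓ → Set (a ⊔ ℓ)
FinitelyMany S = ∃[ xs ] Enumerates.IsEnumeration S xs

record Signature : Set₁ where
  field
    Rel   : Set
    arity : Rel → ℕ
    Const : Set

open Signature public

-- Terms and formulas whose free variables are among n variables (de Bruijn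
-- indices: a quantifier binds index zero).

data Term (τ : Signature) (n : ℕ) : Set where
  var : Fin n → Term τ n
  con : Const τ → Term τ n

infix  8 _≈ᶠ_
infixr 7 _∧ᶠ_
infix  9 ¬ᶠ_ ∃ᶠ_

-- The remaining connectives and ∀ are classically definable from these.

data Formula (τ : Signature) (n : ℕ) : Set where
  ⊥ᶠ   : Formula τ n
  _≈ᶠ_ : Term τ n → Term τ n → Formula τ n
  rel  : (R : Rel τ) → Vec (Term τ n) (arity τ R) → Formula τ n
  _∧ᶠ_ : Formula τ n → Formula τ n → Formula τ n
  ¬ᶠ_  : Formula τ n → Formula τ n
  ∃ᶠ_  : Formula τ (suc n) → Formula τ n

Sentence : Signature → Set
Sentence τ = Formula τ 0

data IsPP {τ : Signature} : {n : ℕ} → Formula τ n → Set where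
  ⊥ᶠ   : {n : ℕ} → IsPP {n = n} ⊥ᶠ
  _≈ᶠ_ : {n : ℕ} (s t : Term τ n) → IsPP (s ≈ᶠ t)
  rel  : {n : ℕ} (R : Rel τ) (ts : Vec (Term τ n) (arity τ R)) → IsPP (rel R ts)
  _∧ᶠ_ : {n : ℕ} {φ ψ : Formula τ n} → IsPP φ → IsPP ψ → IsPP (φ ∧ᶠ ψ)
  ∃ᶠ_  : {n : ℕ} {φ : Formula τ (suc n)} → IsPP φ → IsPP (∃ᶠ φ)

PPFormula : Signature → ℕ → Set
PPFormula τ n = ∃ (IsPP {τ} {n})

-- The same formula, viewed as having n further (dummy) free variables.  These
-- come after the existing ones, so that bound variables keep their indices.

weakenTerm : {τ : Signature} {k : ℕ} (n : ℕ) → Term τ k → Term τ (k + n)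
weakenTerm n (var i) = var (i ↑ˡ n)
weakenTerm n (con c) = con c

weaken : {τ : Signature} {k : ℕ} (n : ℕ) → Formula τ k → Formula τ (k + n)
weaken n ⊥ᶠ         = ⊥ᶠ
weaken n (s ≈ᶠ t)   = weakenTerm n s ≈ᶠ weakenTerm n t
weaken n (rel R ts) = rel R (map (weakenTerm n) ts)
weaken n (φ ∧ᶠ ψ)   = weaken n φ ∧ᶠ weaken n ψ
weaken n (¬ᶠ φ)     = ¬ᶠ weaken n φ
weaken n (∃ᶠ φ)     = ∃ᶠ weaken n φ

-- The empty structure is allowed.  A theory containing ∃x. x = x has only
-- nonempty models, so this subsumes the convention that domains are nonempty.

record Structure (τ : Signature) : Set₁ where
  field
    Carrier : Set
    relᴬ    : (R : Rel τ) → Vec Carrier (arity τ R) → Set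
    conᴬ    : Const τ → Carrier

open Structure public

⟦_⟧ : {τ : Signature} {n : ℕ} → Term τ n → (A : Structure τ) → Vec (Carrier A) n → Carrier A
⟦ var i ⟧ A ρ = lookup ρ i
⟦ con c ⟧ A ρ = conᴬ A c

infix 4 _⊨_[_]

_⊨_[_] : {τ : Signature} {n : ℕ} (A : Structure τ) → Formula τ n → Vec (Carrier A) n → Set
A ⊨ ⊥ᶠ       [ ρ ] = ⊥
A ⊨ s ≈ᶠ t   [ ρ ] = ⟦ s ⟧ A ρ ≡ ⟦ t ⟧ A ρ
A ⊨ rel R ts [ ρ ] = relᴬ A R (map (λ t → ⟦ t ⟧ A ρ) ts)
A ⊨ φ ∧ᶠ ψ   [ ρ ] = (A ⊨ φ [ ρ ]) × (A ⊨ ψ [ ρ ])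
A ⊨ ¬ᶠ φ     [ ρ ] = ¬ (A ⊨ φ [ ρ ])
A ⊨ ∃ᶠ φ     [ ρ ] = ∃[ a ] (A ⊨ φ [ a ∷ ρ ])

_IsModelOf_ : {τ : Signature} → Structure τ → Pred (Sentence τ) 0ℓ → Set
A IsModelOf T = ∀ {φ} → φ ∈ T → A ⊨ φ [ [] ]

Satisfiable : {τ : Signature} {n : ℕ} → Pred (Formula τ n) 0ℓ → Set₁
Satisfiable {τ} {n} Φ =
  Σ (Structure τ) λ A → ∃[ ρ ] (∀ {φ} → φ ∈ Φ → A ⊨ φ [ ρ ])

record _≅_ {τ : Signature} (A B : Structure τ) : Set where
  field
    bijection : Carrier A ↔ Carrier B
  open Inverse bijection using (to)
  field
    rel-iff : (R : Rel τ) (as : Vec (Carrier A) (arity τ R)) →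
              relᴬ A R as ⇔ relᴬ B R (map to as)
    con-≡   : (c : Const τ) → to (conᴬ A c) ≡ conᴬ B c

Th : {τ : Signature} → Structure τ → Pred (Sentence τ) 0ℓ
Th A φ = A ⊨ φ [ [] ]

-- Over an uncountable signature this no longer bounds the number of types: ω with
-- all its finitary relations is ω-categorical in this sense, since its proper
-- elementary extensions have at least continuum many elements.

ω-Categorical : {τ : Signature} → Structure τ → Set₁
ω-Categorical {τ} A =
  CountablyInfinite (Carrier A) ×
  ((B : Structure τ) → Countable (Carrier B) → B IsModelOf Th A → A ≅ B)

record IsCompletePPTheory {τ : Signature} (T : Pred (Sentence τ) 0ℓ) : Set₁ where
  field
    members     : ∀ {φ} → φ ∈ T → IsPP φ ⊎ (∃[ ψ ] (IsPP ψ × φ ≡ ¬ᶠ ψ))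
    satisfiable : Satisfiable T
    complete    : (φ : Sentence τ) → IsPP φ → (φ ∈ T) ⊎ (¬ᶠ φ ∈ T)

-- T as a set of formulas with free variables among n variables.

_⟨_⟩ : {τ : Signature} → Pred (Sentence τ) 0ℓ → (n : ℕ) → Pred (Formula τ n) 0ℓ
(T ⟨ n ⟩) φ = ∃[ σ ] (σ ∈ T × weaken n σ ≡ φ)

module _ {τ : Signature} (T : Pred (Sentence τ) 0ℓ) where

  record IsPPType {n : ℕ} (p : Pred (Formula τ n) 0ℓ) : Set₁ where
    field
      pp         : p ⊆ IsPP
      consistent : Satisfiable (p ∪ T ⟨ n ⟩)

  record IsMaximalPPType {n : ℕ} (p : Pred (Formula τ n) 0ℓ) : Set₁ where
    field
      isPPType : IsPPType p
      maximal  : (φ : Formula τ n) → IsPP φ → φ ∉ (T ⟨ n ⟩ ∪ p) →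
                 ¬ Satisfiable (T ⟨ n ⟩ ∪ p ∪ ｛ φ ｝)

  MaximalPPType : ℕ → Set₁
  MaximalPPType n = ∃ (IsMaximalPPType {n})

  -- Maximality says nothing about whether p contains the pp-sentences of T:
  -- adding them to p, or removing them, preserves it.  Types are therefore
  -- identified when they agree modulo T; otherwise a single maximal type would
  -- already yield infinitely many.

  maximalPPTypes : ℕ → Setoid (lsuc 0ℓ) 0ℓ
  maximalPPTypes n = record
    { Carrier       = MaximalPPType n
    ; _≈_           = λ p q → (T ⟨ n ⟩ ∪ proj₁ p) ≐ (T ⟨ n ⟩ ∪ proj₁ q)
    ; isEquivalence = record { refl = ≐-refl ; sym = ≐-sym ; trans = ≐-trans }
    }

  infix 4 _∼_

  _∼_ : {n : ℕ} → PPFormula τ n → PPFormula τ n → Set₁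
  _∼_ {n} (φ₁ , _) (φ₂ , _) =
    (ψ : Formula τ n) → IsPP ψ →
    Satisfiable (｛ φ₁ ｝ ∪ ｛ ψ ｝ ∪ T ⟨ n ⟩) ⇔ Satisfiable (｛ φ₂ ｝ ∪ ｛ ψ ｝ ∪ T ⟨ n ⟩)

  ∼-setoid : ℕ → Setoid 0ℓ (lsuc 0ℓ)
  ∼-setoid n = record
    { Carrier       = PPFormula τ n
    ; _≈_           = _∼_
    ; isEquivalence = record
      { refl  = λ ψ pp → E.refl
      ; sym   = λ e ψ pp → E.sym (e ψ pp)
      ; trans = λ e f ψ pp → E.trans (e ψ pp) (f ψ pp)
      }
    }
    where module E = IsEquivalence (⇔-isEquivalence {lsuc 0ℓ})

  HasFiniteOrω-CategoricalModel : Set₁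
  HasFiniteOrω-CategoricalModel =
    Σ (Structure τ) λ A → A IsModelOf T × (Finite (Carrier A) ⊎ ω-Categorical A)

  FiniteIndex : Set₁
  FiniteIndex = (n : ℕ) → FinitelyMany (∼-setoid n)

  FinitelyManyMaximalPPTypes : Set₁
  FinitelyManyMaximalPPTypes = (n : ℕ) → FinitelyMany (maximalPPTypes n)

{-# OPTIONS --safe #-}
module Submission where

-- Let A be a countable model of T that is closed under pp-formulas: whatever fails at a tuple is
-- excluded, modulo T, by a pp-formula that holds there.  A generic sequence of finite sets of
-- pp-formulas, each satisfied in some fixed nonempty model of T, produces one.
--
-- (ii) ⇒ (i): each tuple of A is isolated by the conjunction of those of the finitely many
-- representatives of ∼ that it satisfies, and back-and-forth along these formulas identifies A with
-- every countable model of Th A.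
-- (i) ⇒ (ii): if infinitely many pp-formulas are inequivalent over A, some complete type is not
-- isolated; compactness realises it and omitting types omits it in countable models of Th A.
-- (ii) ⇒ (iii): by compactness, membership in a maximal type is invariant under ∼.
-- (iii) ⇒ (ii): in A the pp-type of every tuple is maximal, so ∼ is determined by the maximal types.
-- An empty model of T is finite and is treated apart.

open import Defs
open import Axiom.ExcludedMiddle using (ExcludedMiddle)
open import Data.Bool using (if_then_else_)
open import Data.Empty using (⊥; ⊥-elim)
open import Data.Fin using (Fin; zero; suc; toℕ; fromℕ<; _↑ˡ_; _↑ʳ_)
open import Data.Fin.Properties using (toℕ<n; toℕ-injective; toℕ-fromℕ<)
open import Data.List using (List; []; _∷_; foldr) renaming (_++_ to _++ˡ_)
import Data.List as List
open import Data.List.Membership.Propositional using (find) renaming (_∈_ to _∈ˡ_)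
open import Data.List.Membership.Propositional.Properties using (∈-++⁺ˡ; ∈-++⁺ʳ; ∈-map⁺; ∈-cartesianProductWith⁺; ∈-tabulate⁺; ∈-filter⁺; ∈-filter⁻)
open import Data.List.Relation.Unary.All using (All; []; _∷_)
import Data.List.Relation.Unary.All as All
import Data.List.Relation.Unary.All.Properties as All
open import Data.List.Relation.Unary.Any using (here; there)
import Data.List.Relation.Unary.Any as Any
open import Data.Maybe using (Maybe; just; nothing; _>>=_)
open import Data.Nat using (ℕ; zero; suc; _+_; _⊔_; _≤_; _<_; s≤s; s≤s⁻¹; _≤′_; ≤′-refl; ≤′-step)
open import Data.Nat.Induction using (<-rec)
open import Data.Nat.Properties
open import Data.Product using (Σ; ∃; ∃-syntax; _×_; _,_; proj₁; proj₂)
open import Data.Sum using (_⊎_; inj₁; inj₂; [_,_]′)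
import Data.Sum as Sum
open import Data.Unit using (⊤; tt)
open import Data.Vec using (Vec; []; _∷_; lookup; map; _++_; tabulate; allFin)
open import Data.Vec.Properties using (map-id; map-∘; map-cong; lookup-map; lookup-++ˡ; lookup-++ʳ; map-lookup-allFin; tabulate-∘; tabulate-cong; tabulate∘lookup; lookup∘tabulate)
open import Data.Vec.Membership.Propositional.Properties using (∈-lookup)
open import Data.Vec.Relation.Unary.All using ([]; _∷_) renaming (All to Allᵛ)
import Data.Vec.Relation.Unary.All as Allᵛ
import Data.Vec.Relation.Unary.All.Properties as Allᵛ
open import Function.Base using (_∘_; id)
open import Function.Bundles using (_⇔_; _↔_; _↣_; mk⇔; mk↔ₛ′; mk↣; Equivalence; Inverse; Injection)
open import Level using (Level; 0ℓ; Lift; lift; lower) renaming (suc to lsuc; _⊔_ to _⊔ᴸ_)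
open import Relation.Binary.Bundles using (Setoid)
open import Relation.Binary.PropositionalEquality using (_≡_; refl; sym; trans; cong; cong₂; subst)
open import Relation.Nullary using (¬_; Dec; yes; no; does; contradiction)
open import Relation.Nullary.Decidable using (map′; decidable-stable; dec-true; dec-false)
open import Relation.Unary using (Pred; _∪_; ｛_｝)

open Equivalence using () renaming (to to ⇒; from to ⇐)

-- Partial enumerations

-- Since T decides every pp-sentence, its models agree on which finite sets of pp-formulas are
-- jointly satisfiable. Satisfiability modulo T, a statement about all structures, can therefore be
-- tested in any single model (`together⁻`). For the same reason no proof calculus occurs: a finite
-- set of formulas counts as consistent when it holds in one fixed model M under some naming of
-- elements by natural numbers. Such a naming needs an element, whence the separate treatment of
-- empty models. The obstacle is that pp-formulas are not closed under negation, so a generic set of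
-- them cannot contain the negation of what it rejects. But each rejection has a finite reason
-- inside the set, and quantifying away the names foreign to the rejected tuple turns this reason
-- into a pp-formula. That is closedness under pp-formulas, and it lets a conjunction of purely
-- positive information isolate a tuple. The same construction over all formulas yields compactness
-- and omitting types for Th M.

Enumeration : Set → Set
Enumeration A = ℕ → Maybe A

infix 4 _∈ᵉ_
_∈ᵉ_ : {A : Set} → A → Enumeration A → Set
a ∈ᵉ e = ∃[ i ] e i ≡ just a

-- Cantor's walk: each antidiagonal is run through from (c, 0) to (0, c), and the next one starts at
-- (c + 1, 0).
unpair : ℕ → ℕ × ℕ
unpair zero = 0 , 0
unpair (suc n) with unpair n
... | zero  , b = suc b , 0
... | suc a , b = a , suc b

unpair-surjective : ∀ a b → ∃[ n ] unpair n ≡ (a , b)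
unpair-surjective a b = antidiagonal b a (axis (a + b))
  where
  antidiagonal : ∀ b a → ∃[ n ] unpair n ≡ (a + b , 0) → ∃[ n ] unpair n ≡ (a , b)
  antidiagonal zero a h = subst (λ c → ∃[ n ] unpair n ≡ (c , 0)) (+-identityʳ a) h
  antidiagonal (suc b) a h
    with antidiagonal b (suc a) (subst (λ c → ∃[ n ] unpair n ≡ (c , 0)) (+-suc a b) h)
  ... | n , eq = suc n , next
    where
    next : unpair (suc n) ≡ (a , suc b)
    next rewrite eq = refl
  axis : ∀ c → ∃[ n ] unpair n ≡ (c , 0)
  axis zero = 0 , refl
  axis (suc c) with antidiagonal c 0 (axis c)
  ... | n , eq = suc n , next
    where
    next : unpair (suc n) ≡ (suc c , 0)
    next rewrite eq = refl

infixr 6 _⊗_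
infixr 5 _⊕_

opaque
  pure : {A : Set} → A → Enumeration A
  pure a _ = just a

  ∈-pure : {A : Set} {a : A} → a ∈ᵉ pure a
  ∈-pure = 0 , refl

  _⊗_ : {A B : Set} → Enumeration A → (A → Enumeration B) → Enumeration B
  (e ⊗ f) n = e (proj₁ (unpair n)) >>= λ a → f a (proj₂ (unpair n))

  ∈-⊗ : {A B : Set} {e : Enumeration A} {f : A → Enumeration B} {a : A} {b : B} →
        a ∈ᵉ e → b ∈ᵉ f a → b ∈ᵉ e ⊗ f
  ∈-⊗ {e = e} {f} {b = b} (i , p) (j , q) = proj₁ n , eq
    where
    n : ∃[ n ] unpair n ≡ (i , j)
    n = unpair-surjective i j
    eq : (e ⊗ f) (proj₁ n) ≡ just b
    eq rewrite proj₂ n | p = q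

  _⊕_ : {A : Set} → Enumeration A → Enumeration A → Enumeration A
  (e ⊕ f) n with unpair n
  ... | zero  , j = e j
  ... | suc _ , j = f j

  ∈-⊕ˡ : {A : Set} {e f : Enumeration A} {a : A} → a ∈ᵉ e → a ∈ᵉ e ⊕ f
  ∈-⊕ˡ {e = e} {f} {a} (j , p) = proj₁ n , eq
    where
    n : ∃[ n ] unpair n ≡ (0 , j)
    n = unpair-surjective 0 j
    eq : (e ⊕ f) (proj₁ n) ≡ just a
    eq rewrite proj₂ n = p

  ∈-⊕ʳ : {A : Set} {e f : Enumeration A} {a : A} → a ∈ᵉ f → a ∈ᵉ e ⊕ f
  ∈-⊕ʳ {e = e} {f} {a} (j , p) = proj₁ n , eq
    where
    n : ∃[ n ] unpair n ≡ (1 , j)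
    n = unpair-surjective 1 j
    eq : (e ⊕ f) (proj₁ n) ≡ just a
    eq rewrite proj₂ n = p

fins : ∀ n → Enumeration (Fin n)
fins zero    _       = nothing
fins (suc n) zero    = just zero
fins (suc n) (suc i) = fins n i >>= λ j → just (suc j)

∈-fins : ∀ {n} (i : Fin n) → i ∈ᵉ fins n
∈-fins zero = 0 , refl
∈-fins {suc n} (suc i) with ∈-fins i
... | k , p = suc k , eq
  where
  eq : fins (suc n) (suc k) ≡ just (suc i)
  eq rewrite p = refl

vecs : {A : Set} → Enumeration A → ∀ n → Enumeration (Vec A n)
vecs e zero    = pure []
vecs e (suc n) = e ⊗ λ a → vecs e n ⊗ λ as → pure (a ∷ as)

∈-vecs : {A : Set} {e : Enumeration A} → (∀ a → a ∈ᵉ e) → ∀ {n} (as : Vec A n) → as ∈ᵉ vecs e n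
∈-vecs all []       = ∈-pure
∈-vecs all (a ∷ as) = ∈-⊗ (all a) (∈-⊗ (∈-vecs all as) ∈-pure)

-- Enumeration of formulas

depth : ∀ {τ n} → Formula τ n → ℕ
depth ⊥ᶠ        = 0
depth (_ ≈ᶠ _)  = 0
depth (rel _ _) = 0
depth (φ ∧ᶠ ψ)  = suc (depth φ ⊔ depth ψ)
depth (¬ᶠ φ)    = suc (depth φ)
depth (∃ᶠ φ)    = suc (depth φ)

module FormulaEnumeration {τ : Signature} (rels : Enumeration (Rel τ)) (∈-rels : ∀ R → R ∈ᵉ rels)
                          (cons : Enumeration (Const τ)) (∈-cons : ∀ c → c ∈ᵉ cons) where

  terms : ∀ n → Enumeration (Term τ n)
  terms n = (fins n ⊗ λ i → pure (var i)) ⊕ (cons ⊗ λ c → pure (con c))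

  ∈-terms : ∀ {n} (t : Term τ n) → t ∈ᵉ terms n
  ∈-terms (var i) = ∈-⊕ˡ (∈-⊗ (∈-fins i) ∈-pure)
  ∈-terms (con c) = ∈-⊕ʳ (∈-⊗ (∈-cons c) ∈-pure)

  atoms : ∀ n → Enumeration (Formula τ n)
  atoms n = pure ⊥ᶠ
          ⊕ (terms n ⊗ λ s → terms n ⊗ λ t → pure (s ≈ᶠ t))
          ⊕ (rels ⊗ λ R → vecs (terms n) (arity τ R) ⊗ λ ts → pure (rel R ts))

  -- The bound on the depth is what decreases, since the number of variables grows under ∃.
  -- `formulas` lets the bound range over ℕ.
  ofDepth : ℕ → ∀ n → Enumeration (Formula τ n)
  ofDepth zero    n = atoms n
  ofDepth (suc k) n = atoms n
                    ⊕ (ofDepth k n ⊗ λ φ → ofDepth k n ⊗ λ ψ → pure (φ ∧ᶠ ψ))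
                    ⊕ (ofDepth k n ⊗ λ φ → pure (¬ᶠ φ))
                    ⊕ (ofDepth k (suc n) ⊗ λ φ → pure (∃ᶠ φ))

  atoms⊆ofDepth : ∀ k {n} {φ : Formula τ n} → φ ∈ᵉ atoms n → φ ∈ᵉ ofDepth k n
  atoms⊆ofDepth zero    h = h
  atoms⊆ofDepth (suc k) h = ∈-⊕ˡ h

  ∈-ofDepth : ∀ k {n} (φ : Formula τ n) → depth φ ≤ k → φ ∈ᵉ ofDepth k n
  ∈-ofDepth k ⊥ᶠ _ = atoms⊆ofDepth k (∈-⊕ˡ ∈-pure)
  ∈-ofDepth k (s ≈ᶠ t) _ = atoms⊆ofDepth k (∈-⊕ʳ (∈-⊕ˡ (∈-⊗ (∈-terms s) (∈-⊗ (∈-terms t) ∈-pure))))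
  ∈-ofDepth k (rel R ts) _ =
    atoms⊆ofDepth k (∈-⊕ʳ (∈-⊕ʳ (∈-⊗ (∈-rels R) (∈-⊗ (∈-vecs ∈-terms ts) ∈-pure))))
  ∈-ofDepth (suc k) (φ ∧ᶠ ψ) (s≤s h) = ∈-⊕ʳ (∈-⊕ˡ (∈-⊗
    (∈-ofDepth k φ (≤-trans (m≤m⊔n (depth φ) (depth ψ)) h))
    (∈-⊗ (∈-ofDepth k ψ (≤-trans (m≤n⊔m (depth φ) (depth ψ)) h)) ∈-pure)))
  ∈-ofDepth (suc k) (¬ᶠ φ) (s≤s h) = ∈-⊕ʳ (∈-⊕ʳ (∈-⊕ˡ (∈-⊗ (∈-ofDepth k φ h) ∈-pure)))
  ∈-ofDepth (suc k) (∃ᶠ φ) (s≤s h) = ∈-⊕ʳ (∈-⊕ʳ (∈-⊕ʳ (∈-⊗ (∈-ofDepth k φ h) ∈-pure)))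

  formulas : ∀ n → Enumeration (Formula τ n)
  formulas n = just ⊗ λ k → ofDepth k n

  ∈-formulas : ∀ {n} (φ : Formula τ n) → φ ∈ᵉ formulas n
  ∈-formulas φ = ∈-⊗ {e = just} (depth φ , refl) (∈-ofDepth (depth φ) φ ≤-refl)

-- Generic sequences

-- The Rasiowa-Sikorski lemma for countably many dense sets. The conditions will be finite sets of
-- instances, finite sets of formulas that cut out a large set of tuples, and finite pp-equivalent
-- matchings of two structures.
module Chain {s : Level} {S : Set s} {R : Set} (_≼_ : S → S → Set) (≼-refl : ∀ {s} → s ≼ s)
             (≼-trans : ∀ {s t u} → s ≼ t → t ≼ u → s ≼ u)
             (requirements : Enumeration R) (Meets : R → S → Set)
             (dense : ∀ r s → ∃[ t ] (s ≼ t × Meets r t)) (s₀ : S) where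

  step : Maybe R → S → S
  step nothing  s = s
  step (just r) s = proj₁ (dense r s)

  opaque
    chain : ℕ → S
    chain zero    = s₀
    chain (suc i) = step (requirements i) (chain i)

    chain-suc : ∀ i → chain i ≼ chain (suc i)
    chain-suc i with requirements i
    ... | nothing = ≼-refl
    ... | just r  = proj₁ (proj₂ (dense r (chain i)))

    chain-mono : ∀ {i j} → i ≤ j → chain i ≼ chain j
    chain-mono i≤j = go (≤⇒≤′ i≤j)
      where
      go : ∀ {i j} → i ≤′ j → chain i ≼ chain j
      go ≤′-refl         = ≼-refl
      go (≤′-step {j} h) = ≼-trans (go h) (chain-suc j)

    chain-meets : ∀ {r} → r ∈ᵉ requirements → ∃[ i ] Meets r (chain i)
    chain-meets {r} (i , eq) = suc i , h
      where
      h : Meets r (step (requirements i) (chain i))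
      h rewrite eq = proj₂ (proj₂ (dense r (chain i)))

gather-stages : {X : Set} (stage : ℕ → List X) → (∀ {i j} → i ≤ j → ∀ {x} → x ∈ˡ stage i → x ∈ˡ stage j) →
         ∀ {xs} → All (λ x → ∃[ i ] x ∈ˡ stage i) xs → ∃[ i ] All (_∈ˡ stage i) xs
gather-stages stage mono [] = 0 , []
gather-stages stage mono ((i , x∈) ∷ hs) with gather-stages stage mono hs
... | j , xs∈ = i ⊔ j , mono (m≤m⊔n i j) x∈ ∷ All.map (mono (m≤n⊔m i j)) xs∈

-- Classical combinatorics

module Classical (em : ExcludedMiddle (lsuc 0ℓ)) where

  opaque
    dec : (P : Set) → Dec P
    dec P = map′ lower lift (em {Lift (lsuc 0ℓ) P})

  stable : {P : Set} → ¬ ¬ P → P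
  stable = decidable-stable (dec _)

  opaque
    least : (P : Pred ℕ 0ℓ) → ∃ P → ∃[ m ] (P m × (∀ {k} → P k → m ≤ k))
    least P (n , Pn) = <-rec (λ n → P n → ∃[ m ] (P m × (∀ {k} → P k → m ≤ k))) search n Pn
      where
      search : ∀ n → (∀ {k} → k < n → P k → ∃[ m ] (P m × (∀ {k} → P k → m ≤ k))) →
               P n → ∃[ m ] (P m × (∀ {k} → P k → m ≤ k))
      search n rec Pn with dec (∃[ k ] (k < n × P k))
      ... | yes (k , k<n , Pk) = rec k<n Pk
      ... | no ¬smaller        = n , Pn , λ Pk → ≮⇒≥ (λ k<n → ¬smaller (_ , k<n , Pk))

  module _ {A : Set} (c : Countable A) where
    open Injection c using (to; injective)

    opaque
      enumerate : Enumeration A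
      enumerate i with dec (∃[ a ] to a ≡ i)
      ... | yes (a , _) = just a
      ... | no _        = nothing

      ∈-enumerate : ∀ a → a ∈ᵉ enumerate
      ∈-enumerate a = to a , found
        where
        found : enumerate (to a) ≡ just a
        found with dec (∃[ b ] to b ≡ to a)
        ... | yes (b , eq) = cong just (injective eq)
        ... | no ¬b        = contradiction (a , refl) ¬b

    count : ℕ → ℕ
    count zero = 0
    count (suc m) = if does (dec (∃[ a ] to a ≡ m)) then suc (count m) else count m

    rank : A → ℕ
    rank a = count (to a)

    count-suc : ∀ a → count (suc (to a)) ≡ suc (rank a)
    count-suc a rewrite dec-true (dec (∃[ b ] to b ≡ to a)) (a , refl) = refl

    count-mono : ∀ {m n} → m ≤ n → count m ≤ count n
    count-mono m≤n = go (≤⇒≤′ m≤n)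
      where
      increasing : ∀ m → count m ≤ count (suc m)
      increasing m with dec (∃[ a ] to a ≡ m)
      ... | yes _ = n≤1+n _
      ... | no _  = ≤-refl
      go : ∀ {m n} → m ≤′ n → count m ≤ count n
      go ≤′-refl         = ≤-refl
      go (≤′-step {n} h) = ≤-trans (go h) (increasing n)

    rank-mono : ∀ {a b} → to a < to b → rank a < rank b
    rank-mono {a} lt = ≤-trans (≤-reflexive (sym (count-suc a))) (count-mono lt)

    rank-injective : ∀ {a b} → rank a ≡ rank b → a ≡ b
    rank-injective {a} {b} eq = injective (≤-antisym
      (≮⇒≥ (λ lt → <-irrefl (sym eq) (rank-mono lt)))
      (≮⇒≥ (λ lt → <-irrefl eq (rank-mono lt))))

    -- `count` rises by at most one at each step, so it skips no value.
    rank-onto : ∀ m {k} → k < count m → ∃[ a ] rank a ≡ k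
    rank-onto (suc m) {k} k< with dec (∃[ a ] to a ≡ m)
    ... | no _ = rank-onto m k<
    ... | yes (a , a↦m) with m≤n⇒m<n∨m≡n (s≤s⁻¹ k<)
    ...   | inj₁ k<m   = rank-onto m k<m
    ...   | inj₂ k≡m = a , trans (cong count a↦m) (sym k≡m)

    -- Ranks form an initial segment of ℕ. If some number is missed, the least such k bounds every
    -- rank, because a rank of k or more would make `rank-onto` hit k; below k, minimality leaves no
    -- gap.
    finite-or-infinite : Finite A ⊎ CountablyInfinite A
    finite-or-infinite with dec (∃[ k ] ¬ (∃[ a ] rank a ≡ k))
    ... | no onto = inj₂ (mk↔ₛ′ (λ k → proj₁ (hit k)) rank
                           (λ a → rank-injective (proj₂ (hit (rank a)))) (λ k → proj₂ (hit k)))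
      where
      hit : ∀ k → ∃[ a ] rank a ≡ k
      hit k = stable (λ missed → onto (k , missed))
    ... | yes gap with least _ gap
    ...   | k , missed , minimal = inj₁ (k , mk↔ₛ′ (λ i → proj₁ (hit i)) (λ a → fromℕ< (below a))
              (λ a → rank-injective (trans (proj₂ (hit (fromℕ< (below a)))) (toℕ-fromℕ< (below a))))
              (λ i → toℕ-injective (trans (toℕ-fromℕ< (below (proj₁ (hit i)))) (proj₂ (hit i)))))
      where
      below : ∀ a → rank a < k
      below a = ≰⇒> (λ le → missed (rank-onto (suc (to a)) (subst (k <_) (sym (count-suc a)) (s≤s le))))
      hit : (i : Fin k) → ∃[ a ] rank a ≡ toℕ i
      hit i = stable (λ ¬hit → <⇒≱ (toℕ<n i) (minimal ¬hit))

-- Syntax and semantics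

conj : ∀ {τ n} → Formula τ n → List (Formula τ n) → Formula τ n
conj = foldr _∧ᶠ_

close : ∀ {τ} n → Formula τ n → Sentence τ
close zero    φ = φ
close (suc n) φ = close n (∃ᶠ φ)

∃* : ∀ {τ} k {n} → Formula τ (k + n) → Formula τ n
∃* zero    φ = φ
∃* (suc k) φ = ∃* k (∃ᶠ φ)

renameTerm : ∀ {τ m n} → Vec (Fin m) n → Term τ n → Term τ m
renameTerm w (var i) = var (lookup w i)
renameTerm w (con c) = con c

rename : ∀ {τ m n} → Vec (Fin m) n → Formula τ n → Formula τ m
rename w ⊥ᶠ         = ⊥ᶠ
rename w (s ≈ᶠ t)   = renameTerm w s ≈ᶠ renameTerm w t
rename w (rel R ts) = rel R (map (renameTerm w) ts)
rename w (φ ∧ᶠ ψ)   = rename w φ ∧ᶠ rename w ψ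
rename w (¬ᶠ φ)     = ¬ᶠ rename w φ
rename w (∃ᶠ φ)     = ∃ᶠ rename (zero ∷ map suc w) φ

conj-pp : ∀ {τ n} {φ : Formula τ n} {Δ} → IsPP φ → All IsPP Δ → IsPP (conj φ Δ)
conj-pp pφ []       = pφ
conj-pp pφ (p ∷ ps) = p ∧ᶠ conj-pp pφ ps

close-pp : ∀ {τ} n {φ : Formula τ n} → IsPP φ → IsPP (close n φ)
close-pp zero    p = p
close-pp (suc n) p = close-pp n (∃ᶠ p)

∃*-pp : ∀ {τ} k {n} {φ : Formula τ (k + n)} → IsPP φ → IsPP (∃* k φ)
∃*-pp zero    p = p
∃*-pp (suc k) p = ∃*-pp k (∃ᶠ p)

rename-pp : ∀ {τ m n} (w : Vec (Fin m) n) {φ : Formula τ n} → IsPP φ → IsPP (rename w φ)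
rename-pp w ⊥ᶠ         = ⊥ᶠ
rename-pp w (s ≈ᶠ t)   = renameTerm w s ≈ᶠ renameTerm w t
rename-pp w (rel R ts) = rel R (map (renameTerm w) ts)
rename-pp w (p ∧ᶠ q)   = rename-pp w p ∧ᶠ rename-pp w q
rename-pp w (∃ᶠ p)     = ∃ᶠ rename-pp (zero ∷ map suc w) p

≡⇒⇔ : {P Q : Set} → P ≡ Q → P ⇔ Q
≡⇒⇔ refl = mk⇔ id id

module _ {τ : Signature} (A : Structure τ) where

  conj⁺ : ∀ {n φ Δ} {ρ : Vec (Carrier A) n} →
          A ⊨ φ [ ρ ] → All (λ ψ → A ⊨ ψ [ ρ ]) Δ → A ⊨ conj φ Δ [ ρ ]
  conj⁺ h []       = h
  conj⁺ h (k ∷ ks) = k , conj⁺ h ks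

  conj⁻ : ∀ {n φ} Δ {ρ : Vec (Carrier A) n} →
          A ⊨ conj φ Δ [ ρ ] → A ⊨ φ [ ρ ] × All (λ ψ → A ⊨ ψ [ ρ ]) Δ
  conj⁻ []      h       = h , []
  conj⁻ (ψ ∷ Δ) (k , h) with conj⁻ Δ h
  ... | hφ , ks = hφ , k ∷ ks

  close⁺ : ∀ {n} {φ : Formula τ n} ρ → A ⊨ φ [ ρ ] → A ⊨ close n φ [ [] ]
  close⁺ []      h = h
  close⁺ (a ∷ ρ) h = close⁺ ρ (a , h)

  close⁻ : ∀ n {φ : Formula τ n} → A ⊨ close n φ [ [] ] → ∃[ ρ ] A ⊨ φ [ ρ ]
  close⁻ zero    h = [] , h
  close⁻ (suc n) h with close⁻ n h
  ... | ρ , a , k = a ∷ ρ , k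

  ∃*⁺ : ∀ {k n} {φ : Formula τ (k + n)} (η : Vec (Carrier A) k) {ρ} →
        A ⊨ φ [ η ++ ρ ] → A ⊨ ∃* k φ [ ρ ]
  ∃*⁺ []      h = h
  ∃*⁺ (a ∷ η) h = ∃*⁺ η (a , h)

  ∃*⁻ : ∀ k {n} {φ : Formula τ (k + n)} {ρ} → A ⊨ ∃* k φ [ ρ ] → ∃[ η ] A ⊨ φ [ η ++ ρ ]
  ∃*⁻ zero    h = [] , h
  ∃*⁻ (suc k) h with ∃*⁻ k h
  ... | η , a , h′ = a ∷ η , h′

  ⟦weakenTerm⟧ : ∀ {k n} (t : Term τ k) (ρ : Vec (Carrier A) k) (ρ′ : Vec (Carrier A) n) →
                 ⟦ weakenTerm n t ⟧ A (ρ ++ ρ′) ≡ ⟦ t ⟧ A ρ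
  ⟦weakenTerm⟧ (var i) ρ ρ′ = lookup-++ˡ ρ ρ′ i
  ⟦weakenTerm⟧ (con c) ρ ρ′ = refl

  ⊨-weaken : ∀ {k n} (φ : Formula τ k) (ρ : Vec (Carrier A) k) (ρ′ : Vec (Carrier A) n) →
             A ⊨ weaken n φ [ ρ ++ ρ′ ] ⇔ A ⊨ φ [ ρ ]
  ⊨-weaken ⊥ᶠ ρ ρ′ = mk⇔ id id
  ⊨-weaken (s ≈ᶠ t) ρ ρ′ = ≡⇒⇔ (cong₂ _≡_ (⟦weakenTerm⟧ s ρ ρ′) (⟦weakenTerm⟧ t ρ ρ′))
  ⊨-weaken {n = n} (rel R ts) ρ ρ′ = ≡⇒⇔ (cong (relᴬ A R)
    (trans (sym (map-∘ (λ t → ⟦ t ⟧ A (ρ ++ ρ′)) (weakenTerm n) ts))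
           (map-cong (λ t → ⟦weakenTerm⟧ t ρ ρ′) ts)))
  ⊨-weaken (φ ∧ᶠ ψ) ρ ρ′ =
    mk⇔ (λ (h , k) → ⇒ (⊨-weaken φ ρ ρ′) h , ⇒ (⊨-weaken ψ ρ ρ′) k)
        (λ (h , k) → ⇐ (⊨-weaken φ ρ ρ′) h , ⇐ (⊨-weaken ψ ρ ρ′) k)
  ⊨-weaken (¬ᶠ φ) ρ ρ′ =
    mk⇔ (λ h k → h (⇐ (⊨-weaken φ ρ ρ′) k)) (λ h k → h (⇒ (⊨-weaken φ ρ ρ′) k))
  ⊨-weaken (∃ᶠ φ) ρ ρ′ =
    mk⇔ (λ (a , h) → a , ⇒ (⊨-weaken φ (a ∷ ρ) ρ′) h) (λ (a , h) → a , ⇐ (⊨-weaken φ (a ∷ ρ) ρ′) h)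

  ⟦renameTerm⟧ : ∀ {m n} (w : Vec (Fin m) n) (t : Term τ n) (ρ : Vec (Carrier A) m) →
                 ⟦ renameTerm w t ⟧ A ρ ≡ ⟦ t ⟧ A (map (lookup ρ) w)
  ⟦renameTerm⟧ w (var i) ρ = sym (lookup-map i (lookup ρ) w)
  ⟦renameTerm⟧ w (con c) ρ = refl

  lookup-lift : ∀ {m n} (w : Vec (Fin m) n) (a : Carrier A) (ρ : Vec (Carrier A) m) →
                map (lookup (a ∷ ρ)) (zero ∷ map suc w) ≡ a ∷ map (lookup ρ) w
  lookup-lift w a ρ = cong (a ∷_) (sym (map-∘ (lookup (a ∷ ρ)) suc w))

  ⊨-rename : ∀ {m n} (w : Vec (Fin m) n) (φ : Formula τ n) (ρ : Vec (Carrier A) m) →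
             A ⊨ rename w φ [ ρ ] ⇔ A ⊨ φ [ map (lookup ρ) w ]
  ⊨-rename w ⊥ᶠ ρ = mk⇔ id id
  ⊨-rename w (s ≈ᶠ t) ρ = ≡⇒⇔ (cong₂ _≡_ (⟦renameTerm⟧ w s ρ) (⟦renameTerm⟧ w t ρ))
  ⊨-rename w (rel R ts) ρ = ≡⇒⇔ (cong (relᴬ A R)
    (trans (sym (map-∘ (λ t → ⟦ t ⟧ A ρ) (renameTerm w) ts))
           (map-cong (λ t → ⟦renameTerm⟧ w t ρ) ts)))
  ⊨-rename w (φ ∧ᶠ ψ) ρ =
    mk⇔ (λ (h , k) → ⇒ (⊨-rename w φ ρ) h , ⇒ (⊨-rename w ψ ρ) k)
        (λ (h , k) → ⇐ (⊨-rename w φ ρ) h , ⇐ (⊨-rename w ψ ρ) k)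
  ⊨-rename w (¬ᶠ φ) ρ =
    mk⇔ (λ h k → h (⇐ (⊨-rename w φ ρ) k)) (λ h k → h (⇒ (⊨-rename w φ ρ) k))
  ⊨-rename w (∃ᶠ φ) ρ = mk⇔
    (λ (a , h) → a , subst (λ η → A ⊨ φ [ η ]) (lookup-lift w a ρ) (⇒ (⊨-rename _ φ (a ∷ ρ)) h))
    (λ (a , h) → a , ⇐ (⊨-rename _ φ (a ∷ ρ)) (subst (λ η → A ⊨ φ [ η ]) (sym (lookup-lift w a ρ)) h))

  ⟦vars⟧ : ∀ {n} (ρ : Vec (Carrier A) n) → map (λ t → ⟦ t ⟧ A ρ) (map var (allFin n)) ≡ ρ
  ⟦vars⟧ ρ = trans (sym (map-∘ (λ t → ⟦ t ⟧ A ρ) var (allFin _))) (map-lookup-allFin ρ)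

module _ {τ : Signature} {A B : Structure τ} (iso : A ≅ B) where
  open _≅_ iso
  open Inverse bijection using (to; from; strictlyInverseˡ; strictlyInverseʳ)

  ⟦⟧-≅ : ∀ {n} (t : Term τ n) (ρ : Vec (Carrier A) n) → to (⟦ t ⟧ A ρ) ≡ ⟦ t ⟧ B (map to ρ)
  ⟦⟧-≅ (var i) ρ = sym (lookup-map i to ρ)
  ⟦⟧-≅ (con c) ρ = con-≡ c

  to-injective : ∀ {a b} → to a ≡ to b → a ≡ b
  to-injective eq = trans (sym (strictlyInverseʳ _)) (trans (cong from eq) (strictlyInverseʳ _))

  ⊨-≅ : ∀ {n} (φ : Formula τ n) (ρ : Vec (Carrier A) n) → A ⊨ φ [ ρ ] ⇔ B ⊨ φ [ map to ρ ]
  ⊨-≅ ⊥ᶠ ρ = mk⇔ id id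
  ⊨-≅ (s ≈ᶠ t) ρ = mk⇔
    (λ eq → trans (sym (⟦⟧-≅ s ρ)) (trans (cong to eq) (⟦⟧-≅ t ρ)))
    (λ eq → to-injective (trans (⟦⟧-≅ s ρ) (trans eq (sym (⟦⟧-≅ t ρ)))))
  ⊨-≅ (rel R ts) ρ = mk⇔
    (λ h → subst (relᴬ B R) eq (⇒ (rel-iff R _) h))
    (λ h → ⇐ (rel-iff R _) (subst (relᴬ B R) (sym eq) h))
    where
    eq : map to (map (λ t → ⟦ t ⟧ A ρ) ts) ≡ map (λ t → ⟦ t ⟧ B (map to ρ)) ts
    eq = trans (sym (map-∘ to _ ts)) (map-cong (λ t → ⟦⟧-≅ t ρ) ts)
  ⊨-≅ (φ ∧ᶠ ψ) ρ = mk⇔ (λ (h , k) → ⇒ (⊨-≅ φ ρ) h , ⇒ (⊨-≅ ψ ρ) k)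
                       (λ (h , k) → ⇐ (⊨-≅ φ ρ) h , ⇐ (⊨-≅ ψ ρ) k)
  ⊨-≅ (¬ᶠ φ) ρ = mk⇔ (λ h k → h (⇐ (⊨-≅ φ ρ) k)) (λ h k → h (⇒ (⊨-≅ φ ρ) k))
  ⊨-≅ (∃ᶠ φ) ρ = mk⇔
    (λ (a , h) → to a , ⇒ (⊨-≅ φ (a ∷ ρ)) h)
    (λ (b , h) → from b , ⇐ (⊨-≅ φ (from b ∷ ρ))
      (subst (λ c → B ⊨ φ [ c ∷ map to ρ ]) (sym (strictlyInverseˡ b)) h))

-- The natural numbers serve as names of elements: φ at v is a Henkin sentence without substitution.

data Instance (τ : Signature) : Set where
  _at_ : ∀ {n} → Formula τ n → Vec ℕ n → Instance τ

Holds : ∀ {τ} (A : Structure τ) → (ℕ → Carrier A) → Instance τ → Set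
Holds A s (φ at v) = A ⊨ φ [ map s v ]

Below : ∀ {τ} → ℕ → Instance τ → Set
Below N (φ at v) = Allᵛ (_< N) v

PP : ∀ {τ} → Instance τ → Set
PP (φ at v) = IsPP φ

Allᵛ-bound : ∀ {n} (v : Vec ℕ n) → ∃[ N ] Allᵛ (_< N) v
Allᵛ-bound [] = 0 , []
Allᵛ-bound (i ∷ v) with Allᵛ-bound v
... | N , h = suc i ⊔ N , m≤m⊔n _ N ∷ Allᵛ.map (λ lt → ≤-trans lt (m≤n⊔m (suc i) N)) h

Below-mono : ∀ {τ M N} {f : Instance τ} → M ≤ N → Below M f → Below N f
Below-mono {f = φ at v} M≤N = Allᵛ.map (λ lt → ≤-trans lt M≤N)

Below-bound : ∀ {τ} (Γ : List (Instance τ)) → ∃[ N ] All (Below N) Γ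
Below-bound [] = 0 , []
Below-bound ((φ at v) ∷ Γ) with Allᵛ-bound v | Below-bound Γ
... | M , h | N , hs = M ⊔ N , Below-mono {f = φ at v} (m≤m⊔n M N) h
                             ∷ All.map (λ {f} → Below-mono {f = f} (m≤n⊔m M N)) hs

map-agree : ∀ {X : Set} {N} {s s′ : ℕ → X} → (∀ {i} → i < N → s i ≡ s′ i) →
            ∀ {n} {v : Vec ℕ n} → Allᵛ (_< N) v → map s v ≡ map s′ v
map-agree eq []       = refl
map-agree eq (p ∷ ps) = cong₂ _∷_ (eq p) (map-agree eq ps)

Holds-agree : ∀ {τ} (A : Structure τ) {N} {s s′ : ℕ → Carrier A} → (∀ {i} → i < N → s i ≡ s′ i) →
              ∀ {f} → Below N f → Holds A s f → Holds A s′ f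
Holds-agree A eq {φ at v} b = subst (λ ρ → A ⊨ φ [ ρ ]) (map-agree eq b)

-- A total retraction of ℕ, so that formulas can be translated without carrying bounds on their
-- names; the bounds enter only in `project⁺`. The index set `Fin (suc N)` is nonempty, which
-- provides both a default value and the variable y₀.
clamp : ∀ N → ℕ → Fin (suc N)
clamp zero    _       = zero
clamp (suc N) zero    = zero
clamp (suc N) (suc i) = suc (clamp N i)

toℕ-clamp : ∀ N {i} → i < suc N → toℕ (clamp N i) ≡ i
toℕ-clamp zero    {zero}  _       = refl
toℕ-clamp zero    {suc i} (s≤s ())
toℕ-clamp (suc N) {zero}  _       = refl
toℕ-clamp (suc N) {suc i} (s≤s h) = cong suc (toℕ-clamp N h)

-- The relation that Γ imposes on the elements named by v: ∃y (⋀ x_j = y_{v_j} ∧ ⋀ Γ(y)), where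
-- y₀ = y₀ is the base formula of the conjunction.

module _ {τ : Signature} (N : ℕ) where

  name : ∀ {n} → ℕ → Fin (suc N + n)
  name {n} i = clamp N i ↑ˡ n

  instantiate : ∀ {n} → Instance τ → Formula τ (suc N + n)
  instantiate (φ at u) = rename (map name u) φ

  identify : ∀ {n} → Vec ℕ n → Fin n → Formula τ (suc N + n)
  identify v j = var (suc N ↑ʳ j) ≈ᶠ var (name (lookup v j))

  project : ∀ {n} → Vec ℕ n → List (Instance τ) → Formula τ n
  project v Γ = ∃* (suc N) (conj (var zero ≈ᶠ var zero) (List.tabulate (identify v) ++ˡ List.map instantiate Γ))

  project-pp : ∀ {n} (v : Vec ℕ n) {Γ} → All PP Γ → IsPP (project v Γ)
  project-pp v pps = ∃*-pp (suc N) (conj-pp (var zero ≈ᶠ var zero)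
    (All.++⁺ (All.tabulate⁺ {f = identify v} (λ j → var _ ≈ᶠ var _)) (All.map⁺ (All.map (λ {f} → inst f) pps))))
    where
    inst : ∀ f → PP f → IsPP (instantiate f)
    inst (φ at u) p = rename-pp (map name u) p

  module _ (A : Structure τ) where

    map-name : ∀ {n m} (η : Vec (Carrier A) (suc N)) (ρ : Vec (Carrier A) n) (u : Vec ℕ m) →
               map (lookup (η ++ ρ)) (map name u) ≡ map (λ i → lookup η (clamp N i)) u
    map-name η ρ u = trans (sym (map-∘ (lookup (η ++ ρ)) name u))
                           (map-cong (λ i → lookup-++ˡ η ρ (clamp N i)) u)

    ⊨-instantiate : ∀ {n} (η : Vec (Carrier A) (suc N)) (ρ : Vec (Carrier A) n) f →
                    A ⊨ instantiate f [ η ++ ρ ] ⇔ Holds A (λ i → lookup η (clamp N i)) f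
    ⊨-instantiate η ρ (φ at u) = subst (λ ξ → A ⊨ rename (map name u) φ [ η ++ ρ ] ⇔ A ⊨ φ [ ξ ])
      (map-name η ρ u) (⊨-rename A (map name u) φ (η ++ ρ))

    project⁻ : ∀ {n} (v : Vec ℕ n) Γ {ρ} → A ⊨ project v Γ [ ρ ] →
               ∃[ s ] (map s v ≡ ρ × All (Holds A s) Γ)
    project⁻ v Γ {ρ} h with ∃*⁻ A (suc N) h
    ... | η , k with conj⁻ A (List.tabulate (identify v) ++ˡ List.map instantiate Γ) k
    ...   | _ , ks = s , names v (All.tabulate⁻ (All.++⁻ˡ (List.tabulate (identify v)) ks))
                       , All.map (λ {f} → ⇒ (⊨-instantiate η ρ f))
                                 (All.map⁻ (All.++⁻ʳ (List.tabulate (identify v)) ks))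
      where
      s : ℕ → Carrier A
      s i = lookup η (clamp N i)
      names : ∀ {m} {ρ : Vec (Carrier A) m} (v : Vec ℕ m) → (∀ j → A ⊨ identify v j [ η ++ ρ ]) → map s v ≡ ρ
      names {ρ = ρ} v eqs = lookup-ext (λ j → trans (lookup-map j s v) (sym (trans (sym (lookup-++ʳ η ρ j))
                                 (trans (eqs j) (lookup-++ˡ η ρ (clamp N (lookup v j)))))))
        where
        lookup-ext : ∀ {X : Set} {m} {xs ys : Vec X m} → (∀ j → lookup xs j ≡ lookup ys j) → xs ≡ ys
        lookup-ext {xs = xs} {ys} eq =
          trans (sym (tabulate∘lookup xs)) (trans (tabulate-cong eq) (tabulate∘lookup ys))

    project⁺ : ∀ {n} {v : Vec ℕ n} {Γ} → Allᵛ (_< suc N) v → All (Below (suc N)) Γ →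
               ∀ s → All (Holds A s) Γ → A ⊨ project v Γ [ map s v ]
    project⁺ {v = v} {Γ} bv bΓ s hs = ∃*⁺ A η (conj⁺ A refl
      (All.++⁺ (All.tabulate⁺ eqs) (All.map⁺ (All.zipWith (λ {f} → inst f) (bΓ , hs)))))
      where
      η : Vec (Carrier A) (suc N)
      η = tabulate (s ∘ toℕ)
      agree : ∀ {i} → i < suc N → s i ≡ lookup η (clamp N i)
      agree {i} lt = sym (trans (lookup∘tabulate (s ∘ toℕ) (clamp N i)) (cong s (toℕ-clamp N lt)))
      eqs : ∀ j → A ⊨ identify v j [ η ++ map s v ]
      eqs j = trans (lookup-++ʳ η (map s v) j) (trans (lookup-map j s v)
        (trans (agree (Allᵛ.lookup bv (∈-lookup j v))) (sym (lookup-++ˡ η (map s v) (clamp N (lookup v j))))))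
      inst : ∀ f → Below (suc N) f × Holds A s f → A ⊨ instantiate f [ η ++ map s v ]
      inst f (b , h) = ⇐ (⊨-instantiate η (map s v) f) (Holds-agree A agree {f} b h)

-- The Henkin construction

-- The closure conditions that the truth lemma consumes, weak enough to cover pp-formulas: nothing
-- builds a negation. `∃⁺` is there to give names to constants.
record Fragment {τ : Signature} (K : ∀ {n} → Formula τ n → Set) : Set where
  field
    eq⁺  : ∀ {n} (s t : Term τ n) → K (s ≈ᶠ t)
    rel⁺ : ∀ {n} R (ts : Vec (Term τ n) (arity τ R)) → K (rel R ts)
    ∧⁻   : ∀ {n} {φ ψ : Formula τ n} → K (φ ∧ᶠ ψ) → K φ × K ψ
    ¬⁻   : ∀ {n} {φ : Formula τ n} → K (¬ᶠ φ) → K φ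
    ∃⁻   : ∀ {n} {φ : Formula τ (suc n)} → K (∃ᶠ φ) → K φ
    ∃⁺   : ∀ {n} {φ : Formula τ (suc n)} → K φ → K (∃ᶠ φ)

InFragment : {τ : Signature} (K : ∀ {n} → Formula τ n → Set) → Instance τ → Set
InFragment K (φ at v) = K φ

pp-fragment : {τ : Signature} → Fragment {τ} IsPP
pp-fragment = record
  { eq⁺ = _≈ᶠ_
  ; rel⁺ = rel
  ; ∧⁻ = λ { (p ∧ᶠ q) → p , q }
  ; ¬⁻ = λ ()
  ; ∃⁻ = λ { (∃ᶠ p) → p }
  ; ∃⁺ = ∃ᶠ_
  }

full-fragment : {τ : Signature} → Fragment {τ} (λ _ → ⊤)
full-fragment = record
  { eq⁺ = λ _ _ → tt
  ; rel⁺ = λ _ _ → tt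
  ; ∧⁻ = λ _ → tt , tt
  ; ¬⁻ = λ _ → tt
  ; ∃⁻ = λ _ → tt
  ; ∃⁺ = λ _ → tt
  }

module Countably (em : ExcludedMiddle (lsuc 0ℓ)) (τ : Signature)
                 (countableRel : Countable (Rel τ)) (countableConst : Countable (Const τ)) where

  open Classical em
  open FormulaEnumeration {τ} (enumerate countableRel) (∈-enumerate countableRel)
                          (enumerate countableConst) (∈-enumerate countableConst)

  opaque
    instances : Enumeration (Instance τ)
    instances = just ⊗ λ n → formulas n ⊗ λ φ → vecs just n ⊗ λ v → pure (φ at v)

    ∈-instances : ∀ f → f ∈ᵉ instances
    ∈-instances (_at_ {n} φ v) =
      ∈-⊗ {e = just} {f = λ n → formulas n ⊗ λ φ → vecs just n ⊗ λ v → pure (φ at v)} (n , refl)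
          (∈-⊗ (∈-formulas φ) (∈-⊗ (∈-vecs {e = just} (λ i → i , refl) v) ∈-pure))

  update : {X : Set} → (ℕ → X) → ℕ → X → ℕ → X
  update s c a i = if does (i ≟ c) then a else s i

  update-same : {X : Set} (s : ℕ → X) (c : ℕ) (a : X) → update s c a c ≡ a
  update-same s c a rewrite dec-true (c ≟ c) refl = refl

  update-below : {X : Set} (s : ℕ → X) {c : ℕ} (a : X) {i : ℕ} → i < c → s i ≡ update s c a i
  update-below s {c} a {i} lt rewrite dec-false (i ≟ c) (<⇒≢ lt) = refl

  Witnessed : Instance τ → List (Instance τ) → Set
  Witnessed ((∃ᶠ φ) at v) Γ = ∃[ c ] (φ at (c ∷ v)) ∈ˡ Γ
  Witnessed _             Γ = ⊤

  Witnessed-mono : ∀ f {Γ Δ} → (∀ {g} → g ∈ˡ Γ → g ∈ˡ Δ) → Witnessed f Γ → Witnessed f Δ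
  Witnessed-mono (⊥ᶠ at v)       Γ⊆Δ _       = tt
  Witnessed-mono ((_ ≈ᶠ _) at v) Γ⊆Δ _       = tt
  Witnessed-mono (rel _ _ at v)  Γ⊆Δ _       = tt
  Witnessed-mono ((_ ∧ᶠ _) at v) Γ⊆Δ _       = tt
  Witnessed-mono ((¬ᶠ _) at v)   Γ⊆Δ _       = tt
  Witnessed-mono ((∃ᶠ _) at v)   Γ⊆Δ (c , h) = c , Γ⊆Δ h

  -- A maximal set G of instances, all in the fragment K, such that every finite part of G ∪ P holds
  -- in M under some naming of elements.  The structure built from G has the names as elements, and
  -- satisfies exactly the instances in G.  P must leave infinitely many names free for witnesses.

  module Henkin (M : Structure τ) (K : ∀ {n} → Formula τ n → Set) (fragment : Fragment {τ} K)
                (P : Pred (Instance τ) 0ℓ) (N : ℕ) (P-bounded : ∀ {f} → P f → Below N f) where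

    Consistent : Pred (List (Instance τ)) 0ℓ
    Consistent Γ = All (InFragment K) Γ ×
                   (∀ Δ → All P Δ → ∃[ s ] (All (Holds M s) Γ × All (Holds M s) Δ))

    infix 4 _⊑_
    _⊑_ : List (Instance τ) → List (Instance τ) → Set
    Γ ⊑ Γ′ = ∀ {f} → f ∈ˡ Γ → f ∈ˡ Γ′

    ⊑-All : ∀ {Q : Pred (Instance τ) 0ℓ} {Γ Γ′} → Γ ⊑ Γ′ → All Q Γ′ → All Q Γ
    ⊑-All Γ⊑Γ′ qs = All.tabulate (λ f∈ → All.lookup qs (Γ⊑Γ′ f∈))

    Consistent-anti : ∀ {Γ Γ′} → Γ ⊑ Γ′ → Consistent Γ′ → Consistent Γ
    Consistent-anti Γ⊑Γ′ (k , h) = ⊑-All Γ⊑Γ′ k , λ Δ pΔ →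
      let s , hΓ , hΔ = h Δ pΔ in s , ⊑-All Γ⊑Γ′ hΓ , hΔ

    fresh-witness : ∀ {n} (φ : Formula τ (suc n)) (v : Vec ℕ n) {Γ} → Consistent ((∃ᶠ φ) at v ∷ Γ) →
                    ∃[ c ] Consistent (φ at (c ∷ v) ∷ (∃ᶠ φ) at v ∷ Γ)
    fresh-witness φ v {Γ} (k ∷ ks , h) = c , Fragment.∃⁻ fragment k ∷ k ∷ ks , extend
      where
      B : ∃[ B ] All (Below B) ((∃ᶠ φ) at v ∷ Γ)
      B = Below-bound ((∃ᶠ φ) at v ∷ Γ)
      c : ℕ
      -- This lies above every name in Γ and every name that P may mention, so reassigning c alone
      -- to the witness a disturbs neither.
      c = proj₁ B ⊔ N
      bounds : All (Below c) ((∃ᶠ φ) at v ∷ Γ)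
      bounds = All.map (λ {f} → Below-mono {f = f} (m≤m⊔n (proj₁ B) N)) (proj₂ B)
      extend : ∀ Δ → All P Δ → ∃[ s ] (All (Holds M s) (φ at (c ∷ v) ∷ (∃ᶠ φ) at v ∷ Γ) × All (Holds M s) Δ)
      extend Δ pΔ with h Δ pΔ
      ... | s , (a , hφ) ∷ hΓ , hΔ = s′ , subst (λ ρ → M ⊨ φ [ ρ ]) names hφ
                                          ∷ keep bounds ((a , hφ) ∷ hΓ)
                                        , keep (All.map (λ {f} p → Below-mono {f = f} (m≤n⊔m (proj₁ B) N)
                                                                              (P-bounded {f} p)) pΔ) hΔ
        where
        s′ : ℕ → Carrier M
        s′ = update s c a
        names : a ∷ map s v ≡ map s′ (c ∷ v)
        names = cong₂ _∷_ (sym (update-same s c a)) (map-agree (update-below s a) (All.head bounds))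
        keep : ∀ {Θ} → All (Below c) Θ → All (Holds M s) Θ → All (Holds M s′) Θ
        keep bs hs = All.zipWith (λ {f} (b , h) → Holds-agree M (update-below s a) {f} b h) (bs , hs)

    add-witness : ∀ f {Γ} → Consistent (f ∷ Γ) → ∃[ Γ′ ] (Consistent Γ′ × f ∷ Γ ⊑ Γ′ × Witnessed f Γ′)
    add-witness (⊥ᶠ at v)       ok = _ , ok , id , tt
    add-witness ((_ ≈ᶠ _) at v) ok = _ , ok , id , tt
    add-witness (rel _ _ at v)  ok = _ , ok , id , tt
    add-witness ((_ ∧ᶠ _) at v) ok = _ , ok , id , tt
    add-witness ((¬ᶠ _) at v)   ok = _ , ok , id , tt
    add-witness ((∃ᶠ φ) at v)   ok with fresh-witness φ v ok
    ... | c , ok′ = _ , ok′ , there , c , here refl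

    -- Consistency quantifies over the finite parts Δ of P, so its failure is already due to one of
    -- them.
    refute : ∀ {f Γ} → InFragment K f → Consistent Γ → ¬ Consistent (f ∷ Γ) →
             ∃[ Δ ] (All P Δ × (∀ s → All (Holds M s) Γ → All (Holds M s) Δ → ¬ Holds M s f))
    refute k (ks , _) ¬ok = stable λ ¬Δ → ¬ok (k ∷ ks , λ Δ pΔ → stable λ ¬s →
      ¬Δ (Δ , pΔ , λ s hΓ hΔ hf → ¬s (s , hf ∷ hΓ , hΔ)))

    -- `Extra` makes room for further dense requirements; omitting types uses it, while compactness
    -- and pp-closed models take it trivial.
    module Generic (consistent₀ : ∀ Δ → All P Δ → ∃[ s ] All (Holds M s) Δ)
                   (Extra : Instance τ → List (Instance τ) → Set)
                   (extra-dense : ∀ f {Γ} → Consistent Γ → ∃[ Γ′ ] (Consistent Γ′ × Γ ⊑ Γ′ × Extra f Γ′)) where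

      Condition : Set
      Condition = ∃ Consistent

      Decides : Instance τ → List (Instance τ) → Set
      Decides f Γ = (f ∈ˡ Γ × Witnessed f Γ) ⊎ ¬ Consistent (f ∷ Γ)

      decide : ∀ f {Γ} → Consistent Γ → ∃[ Γ′ ] (Consistent Γ′ × Γ ⊑ Γ′ × Decides f Γ′)
      decide f {Γ} ok with dec (Consistent (f ∷ Γ))
      ... | no ¬ok = Γ , ok , id , inj₂ ¬ok
      ... | yes ok′ with add-witness f ok′
      ...   | Γ′ , ok″ , ⊑Γ′ , w = Γ′ , ok″ , ⊑Γ′ ∘ there , inj₁ (⊑Γ′ (here refl) , w)

      Decides-mono : ∀ f {Γ Γ′} → Γ ⊑ Γ′ → Decides f Γ → Decides f Γ′
      Decides-mono f Γ⊑Γ′ (inj₁ (f∈ , w)) = inj₁ (Γ⊑Γ′ f∈ , Witnessed-mono f Γ⊑Γ′ w)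
      Decides-mono f Γ⊑Γ′ (inj₂ ¬ok)     = inj₂ λ ok → ¬ok (Consistent-anti
        (λ { (here eq) → here eq ; (there g∈) → there (Γ⊑Γ′ g∈) }) ok)

      dense : ∀ f (p : Condition) → ∃[ q ] (proj₁ p ⊑ proj₁ q × (Decides f (proj₁ q) × Extra f (proj₁ q)))
      dense f (Γ , ok) with decide f ok
      ... | Γ′ , ok′ , Γ⊑Γ′ , d with extra-dense f ok′
      ...   | Γ″ , ok″ , Γ′⊑Γ″ , x = (Γ″ , ok″) , Γ′⊑Γ″ ∘ Γ⊑Γ′ , Decides-mono f Γ′⊑Γ″ d , x

      initial : Condition
      initial = [] , [] , λ Δ pΔ → let s , h = consistent₀ Δ pΔ in s , [] , h

      private
        module Stages = Chain {S = Condition} (λ p q → proj₁ p ⊑ proj₁ q) id (λ p q → q ∘ p) instances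
                              (λ f p → Decides f (proj₁ p) × Extra f (proj₁ p)) dense
                              initial

      opaque
        stage : ℕ → List (Instance τ)
        stage i = proj₁ (Stages.chain i)

        stage-mono : ∀ {i j} → i ≤ j → stage i ⊑ stage j
        stage-mono i≤j = Stages.chain-mono i≤j

        stage-consistent : ∀ i → Consistent (stage i)
        stage-consistent i = proj₂ (Stages.chain i)

        stage-meets : ∀ f → ∃[ i ] (Decides f (stage i) × Extra f (stage i))
        stage-meets f = Stages.chain-meets (∈-instances f)

      G : Pred (Instance τ) 0ℓ
      G f = ∃[ i ] f ∈ˡ stage i

      extra : ∀ f → ∃[ i ] Extra f (stage i)
      extra f with stage-meets f
      ... | i , _ , x = i , x

      stage⊆G : ∀ i → All G (stage i)
      stage⊆G i = All.tabulate (λ f∈ → i , f∈)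

      gather : ∀ {Γ} → All G Γ → ∃[ i ] Γ ⊑ stage i
      gather gs = let i , Γ⊆ = gather-stages stage stage-mono gs in i , All.lookup Γ⊆

      G⊆K : ∀ {Γ} → All G Γ → All (InFragment K) Γ
      G⊆K gs with gather gs
      ... | i , Γ⊑ = ⊑-All Γ⊑ (proj₁ (stage-consistent i))

      consistent : ∀ {Γ Δ} → All G Γ → All P Δ → ∃[ s ] (All (Holds M s) Γ × All (Holds M s) Δ)
      consistent gs pΔ with gather gs
      ... | i , Γ⊑ with proj₂ (stage-consistent i) _ pΔ
      ...   | s , hΓ , hΔ = s , ⊑-All Γ⊑ hΓ , hΔ

      decided : ∀ f → InFragment K f →
                G f ⊎ ∃[ Γ ] ∃[ Δ ] (All G Γ × All P Δ ×
                                     (∀ s → All (Holds M s) Γ → All (Holds M s) Δ → ¬ Holds M s f))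
      decided f k with stage-meets f
      ... | i , inj₁ (f∈ , _) , _ = inj₁ (i , f∈)
      ... | i , inj₂ ¬ok , _ with refute {f} k (stage-consistent i) ¬ok
      ...   | Δ , pΔ , ¬f = inj₂ (stage i , Δ , stage⊆G i , pΔ , ¬f)

      -- Deductive closure, where entailment means truth in M under all namings. Were f rejected,
      -- the finite parts that refute it and those that entail it would hold together under one
      -- naming.
      entail : ∀ {f Γ Δ} → InFragment K f → All G Γ → All P Δ →
               (∀ s → All (Holds M s) Γ → All (Holds M s) Δ → Holds M s f) → G f
      entail {f} {Γ} {Δ} k gs pΔ hf with decided f k
      ... | inj₁ Gf = Gf
      ... | inj₂ (Γ′ , Δ′ , gs′ , pΔ′ , ¬f) with consistent (All.++⁺ gs gs′) (All.++⁺ pΔ pΔ′)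
      ...   | s , hΓ , hΔ = contradiction (hf s (All.++⁻ˡ Γ hΓ) (All.++⁻ˡ Δ hΔ))
                                          (¬f s (All.++⁻ʳ Γ hΓ) (All.++⁻ʳ Δ hΔ))

      entail₀ : ∀ {f Γ} → InFragment K f → All G Γ → (∀ s → All (Holds M s) Γ → Holds M s f) → G f
      entail₀ {f} k gs hf = entail {f} k gs [] (λ s hΓ _ → hf s hΓ)

      P⊆G : ∀ {f} → InFragment K f → P f → G f
      P⊆G {f} k p = entail {f} {[]} k [] (p ∷ []) λ { s [] (h ∷ []) → h }

      witness : ∀ {n} {φ : Formula τ (suc n)} {v} → G ((∃ᶠ φ) at v) → ∃[ c ] G (φ at (c ∷ v))
      witness {φ = φ} {v} g with stage-meets ((∃ᶠ φ) at v)
      ... | i , inj₁ (_ , c , c∈) , _ = c , i , c∈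
      ... | i , inj₂ ¬ok , _ with gather (g ∷ stage⊆G i)
      ...   | j , ⊑j = contradiction (Consistent-anti ⊑j (stage-consistent j)) ¬ok

      complement : ∀ {n} {φ : Formula τ n} {v} → K (¬ᶠ φ) → ¬ G (φ at v) → G ((¬ᶠ φ) at v)
      complement {φ = φ} {v} k ¬g with decided (φ at v) (Fragment.¬⁻ fragment k)
      ... | inj₁ g = contradiction g ¬g
      ... | inj₂ (Γ , Δ , gs , pΔ , ¬f) = entail {(¬ᶠ φ) at v} k gs pΔ ¬f

      Same : ℕ → ℕ → Instance τ
      Same i j = (var zero ≈ᶠ var (suc zero)) at (i ∷ j ∷ [])

      same : ∀ {i j Γ} → All G Γ → (∀ s → All (Holds M s) Γ → s i ≡ s j) → G (Same i j)
      same = entail₀ {Same _ _} (Fragment.eq⁺ fragment _ _)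

      same-refl : ∀ i → G (Same i i)
      same-refl i = same [] (λ s _ → refl)

      representative : ∀ i → ∃[ m ] (G (Same i m) × (∀ {k} → G (Same i k) → m ≤ k))
      representative i = least (λ j → G (Same i j)) (i , same-refl i)

      opaque
        rep : ℕ → ℕ
        rep i = proj₁ (representative i)

        same-rep : ∀ i → G (Same i (rep i))
        same-rep i = proj₁ (proj₂ (representative i))

        rep-cong : ∀ {i j} → G (Same i j) → rep i ≡ rep j
        rep-cong {i} {j} g = ≤-antisym
          (proj₂ (proj₂ (representative i)) (same (g ∷ same-rep j ∷ []) λ { s (p ∷ q ∷ []) → trans p q }))
          (proj₂ (proj₂ (representative j)) (same (g ∷ same-rep i ∷ []) λ { s (p ∷ q ∷ []) → trans (sym p) q }))

      -- Equations are interpreted by `_≡_`, so `Same` has to become propositional equality. The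
      -- quotient is realised by least representatives; irrelevance of equations in ℕ then makes two
      -- classes with the same number equal.
      Class : Set
      Class = ∃[ i ] rep i ≡ i

      class : ℕ → Class
      class i = rep i , sym (rep-cong (same-rep i))

      class-cong : {a b : Class} → proj₁ a ≡ proj₁ b → a ≡ b
      class-cong {_ , p} {_ , q} refl = cong (_ ,_) (≡-irrelevant p q)

      class-proj₁ : (a : Class) → class (proj₁ a) ≡ a
      class-proj₁ a = class-cong (proj₂ a)

      opaque
        -- The sentence ∃x. x = c is true in M, hence lies in G, and its witness names the constant.
        constant : ∀ c → ∃[ i ] G ((var zero ≈ᶠ con c) at (i ∷ []))
        constant c = witness (entail₀ {(∃ᶠ (var zero ≈ᶠ con c)) at []} {[]}
          (Fragment.∃⁺ fragment (Fragment.eq⁺ fragment _ _)) [] (λ s _ → conᴬ M c , refl))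

      model : Structure τ
      model = record
        { Carrier = Class
        ; relᴬ    = λ R as → G (rel R (map var (allFin _)) at map proj₁ as)
        ; conᴬ    = λ c → class (proj₁ (constant c))
        }

      countable : Countable Class
      countable = mk↣ {to = proj₁} class-cong

      value : ∀ {n} → Vec ℕ n → Term τ n → ℕ
      value v t = proj₁ (⟦ t ⟧ model (map class v))

      -- Evaluation in `model` passes to representatives. Finitely many equations of G account for
      -- this, and every naming in M that satisfies them gives the term the same value as its
      -- representative.
      value-correct : ∀ {n} (v : Vec ℕ n) (t : Term τ n) →
                      ∃[ Γ ] (All G Γ × (∀ s → All (Holds M s) Γ → ⟦ t ⟧ M (map s v) ≡ s (value v t)))
      value-correct v (var i) = _ , same-rep (lookup v i) ∷ [] , λ { s (h ∷ []) →
        trans (lookup-map i s v) (trans h (cong (s ∘ proj₁) (sym (lookup-map i class v)))) }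
      value-correct v (con c) = _ , proj₂ (constant c) ∷ same-rep (proj₁ (constant c)) ∷ [] ,
        λ { s (p ∷ q ∷ []) → trans (sym p) q }

      values-correct : ∀ {n m} (v : Vec ℕ n) (ts : Vec (Term τ n) m) →
                       ∃[ Γ ] (All G Γ × (∀ s → All (Holds M s) Γ →
                                          map (λ t → ⟦ t ⟧ M (map s v)) ts ≡ map s (map (value v) ts)))
      values-correct v [] = [] , [] , λ _ _ → refl
      values-correct v (t ∷ ts) with value-correct v t | values-correct v ts
      ... | Γ , gs , h | Γ′ , gs′ , h′ = Γ ++ˡ Γ′ , All.++⁺ gs gs′ , λ s hs →
        cong₂ _∷_ (h s (All.++⁻ˡ Γ hs)) (h′ s (All.++⁻ʳ Γ hs))

      -- In the negation case G contains ¬φ as soon as it rejects φ, by `complement`. This needs ¬φ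
      -- in the fragment, so for pp-formulas the case is vacuous.
      truth : ∀ {n} {φ : Formula τ n} → K φ → (v : Vec ℕ n) → model ⊨ φ [ map class v ] ⇔ G (φ at v)
      truth {φ = ⊥ᶠ} k v = mk⇔ (λ ()) contradictory
        where
        contradictory : ¬ G (⊥ᶠ at v)
        contradictory g with consistent (g ∷ []) []
        ... | s , h ∷ [] , _ = h
      truth {φ = s ≈ᶠ t} k v with value-correct v s | value-correct v t
      ... | Γ , gs , hs | Γ′ , gs′ , ht = mk⇔
        (λ eq → entail₀ {(s ≈ᶠ t) at v} k (All.++⁺ gs gs′) λ σ hσ →
          trans (hs σ (All.++⁻ˡ Γ hσ)) (trans (cong (σ ∘ proj₁) eq) (sym (ht σ (All.++⁻ʳ Γ hσ)))))
        (λ g → class-cong (trans (sym (proj₂ (⟦ s ⟧ model (map class v))))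
          (trans (rep-cong (same (g ∷ All.++⁺ gs gs′) λ { σ (h ∷ hσ) →
                   trans (sym (hs σ (All.++⁻ˡ Γ hσ))) (trans h (ht σ (All.++⁻ʳ Γ hσ))) }))
                 (proj₂ (⟦ t ⟧ model (map class v))))))
      truth {φ = rel R ts} k v with values-correct v ts
      ... | Γ , gs , h = mk⇔
        (λ g → entail₀ {rel R ts at v} k (g ∷ gs) λ { s (hg ∷ hs) → subst (relᴬ M R) (sym (args s hs)) hg })
        (λ g → entail₀ {rel R (map var (allFin _)) at as} (Fragment.rel⁺ fragment _ _) (g ∷ gs)
                 λ { s (hg ∷ hs) → subst (relᴬ M R) (args s hs) hg })
        where
        as : Vec ℕ (arity τ R)
        as = map proj₁ (map (λ t → ⟦ t ⟧ model (map class v)) ts)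
        args : ∀ s → All (Holds M s) Γ →
               map (λ t → ⟦ t ⟧ M (map s v)) ts ≡ map (λ t → ⟦ t ⟧ M (map s as)) (map var (allFin _))
        args s hs = trans (h s hs) (trans (cong (map s) (map-∘ proj₁ _ ts)) (sym (⟦vars⟧ M (map s as))))
      truth {φ = φ ∧ᶠ ψ} k v = mk⇔
        (λ (h , h′) → entail₀ {(φ ∧ᶠ ψ) at v} k (⇒ (truth kφ v) h ∷ ⇒ (truth kψ v) h′ ∷ [])
                        λ { s (p ∷ q ∷ []) → p , q })
        (λ g → ⇐ (truth kφ v) (entail₀ {φ at v} kφ (g ∷ []) λ { s ((p , _) ∷ []) → p })
             , ⇐ (truth kψ v) (entail₀ {ψ at v} kψ (g ∷ []) λ { s ((_ , q) ∷ []) → q }))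
        where
        kφ : K φ
        kφ = proj₁ (Fragment.∧⁻ fragment k)
        kψ : K ψ
        kψ = proj₂ (Fragment.∧⁻ fragment k)
      truth {φ = ¬ᶠ φ} k v = mk⇔
        (λ ¬h → complement k (λ g → ¬h (⇐ (truth kφ v) g)))
        (λ g h → incompatible g (⇒ (truth kφ v) h))
        where
        kφ : K φ
        kφ = Fragment.¬⁻ fragment k
        incompatible : G ((¬ᶠ φ) at v) → ¬ G (φ at v)
        incompatible g g′ with consistent (g ∷ g′ ∷ []) []
        ... | s , ¬h ∷ h ∷ [] , _ = ¬h h
      truth {φ = ∃ᶠ φ} k v = mk⇔
        (λ (a , h) → entail₀ {(∃ᶠ φ) at v} k
          (⇒ (truth kφ (proj₁ a ∷ v))
             (subst (λ b → model ⊨ φ [ b ∷ map class v ]) (sym (class-proj₁ a)) h) ∷ [])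
          λ { s (p ∷ []) → s (proj₁ a) , p })
        (λ g → let c , g′ = witness g in class c , ⇐ (truth kφ (c ∷ v)) g′)
        where
        kφ : K φ
        kφ = Fragment.∃⁻ fragment k

      elementary : ∀ {σ : Sentence τ} → K σ → M ⊨ σ [ [] ] → model ⊨ σ [ [] ]
      elementary {σ} k h = ⇐ (truth k []) (entail₀ {σ at []} {[]} k [] (λ _ _ → h))

      reflects : ∀ {σ : Sentence τ} → K σ → model ⊨ σ [ [] ] → M ⊨ σ [ [] ]
      reflects k h with consistent (⇒ (truth k []) h ∷ []) []
      ... | _ , h′ ∷ [] , _ = h′

      named : ∀ {n} (ρ : Vec Class n) → map class (map proj₁ ρ) ≡ ρ
      named []      = refl
      named (a ∷ ρ) = cong₂ _∷_ (class-proj₁ a) (named ρ)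

  -- Compactness and omitting types

  assign : {X : Set} {n : ℕ} → Vec X n → X → ℕ → X
  assign []      x _       = x
  assign (a ∷ ρ) x zero    = a
  assign (a ∷ ρ) x (suc i) = assign ρ x i

  assign-toℕ : {X : Set} {n : ℕ} (ρ : Vec X n) (x : X) (i : Fin n) → assign ρ x (toℕ i) ≡ lookup ρ i
  assign-toℕ (a ∷ ρ) x zero    = refl
  assign-toℕ (a ∷ ρ) x (suc i) = assign-toℕ ρ x i

  names : ∀ n → Vec ℕ n
  names n = tabulate toℕ

  map-assign : {X : Set} {n : ℕ} (ρ : Vec X n) (x : X) → map (assign ρ x) (names n) ≡ ρ
  map-assign ρ x = trans (sym (tabulate-∘ (assign ρ x) toℕ))
                         (trans (tabulate-cong (assign-toℕ ρ x)) (tabulate∘lookup ρ))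

  vacuously : (M : Structure τ) → Carrier M → ∀ Δ → All (λ _ → ⊥) Δ → ∃[ s ] All (Holds M s) Δ
  vacuously M m [] [] = (λ _ → m) , []

  -- The first n names are reserved for the tuple that realises p, and witnesses are named from n
  -- upwards. Finite satisfiability in M is the consistency from which the construction starts.
  compactness : (M : Structure τ) → Carrier M → ∀ {n} (p : Pred (Formula τ n) 0ℓ) →
                (∀ Δ → All p Δ → ∃[ ρ ] All (λ φ → M ⊨ φ [ ρ ]) Δ) →
                Σ (Structure τ) λ B → Countable (Carrier B) × B IsModelOf Th M ×
                                      ∃[ ρ ] (∀ {φ} → p φ → B ⊨ φ [ ρ ])
  compactness M m {n} p finitely =
    model , countable , (λ {σ} → elementary {σ} tt) , map class (names n) ,
    λ {φ} pφ → ⇐ (truth {φ = φ} tt (names n)) (P⊆G tt (φ , pφ , refl))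
    where
    P : Pred (Instance τ) 0ℓ
    P f = ∃[ φ ] (p φ × f ≡ φ at names n)
    bounded : ∀ {f} → P f → Below n f
    bounded (φ , _ , refl) = Allᵛ.tabulate⁺ toℕ<n
    formulas-of : ∀ {Δ} → All P Δ → ∃[ Φ ] (All p Φ × Δ ≡ List.map (_at names n) Φ)
    formulas-of [] = [] , [] , refl
    formulas-of ((φ , pφ , refl) ∷ ps) with formulas-of ps
    ... | Φ , pΦ , refl = φ ∷ Φ , pφ ∷ pΦ , refl
    satisfied : ∀ Δ → All P Δ → ∃[ s ] All (Holds M s) Δ
    satisfied Δ pΔ with formulas-of pΔ
    ... | Φ , pΦ , refl with finitely Φ pΦ
    ...   | ρ , hs = assign ρ m , All.map⁺ (All.map (λ {φ} → subst (λ η → M ⊨ φ [ η ]) (sym (map-assign ρ m))) hs)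
    open Henkin M (λ _ → ⊤) full-fragment P n bounded
    open Generic satisfied (λ _ _ → ⊤) (λ f ok → _ , ok , id , tt)

  omitting-types : (M : Structure τ) → Carrier M → ∀ {n} (p : Pred (Formula τ n) 0ℓ) →
                   (∀ φ → ∃[ ρ ] M ⊨ φ [ ρ ] → ∃[ ψ ] (p ψ × ∃[ ρ ] (M ⊨ φ [ ρ ] × ¬ (M ⊨ ψ [ ρ ])))) →
                   Σ (Structure τ) λ B → Countable (Carrier B) × B IsModelOf Th M ×
                                         (∀ ρ → ∃[ ψ ] (p ψ × ¬ (B ⊨ ψ [ ρ ])))
  omitting-types M m {n} p nonisolated =
    model , countable , (λ {σ} → elementary {σ} tt) , omitted
    where
    open Henkin M (λ _ → ⊤) full-fragment (λ _ → ⊥) 0 (λ ())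
    Omits : Instance τ → List (Instance τ) → Set
    -- Requirements are indexed by instances; `⊥ᶠ at v` merely labels the requirement that the tuple
    -- v omit p.
    Omits f Γ = ∀ v → f ≡ (⊥ᶠ {n = n}) at v → ∃[ ψ ] (p ψ × ((¬ᶠ ψ) at v) ∈ˡ Γ)
    -- The projection of Γ to v is satisfiable in M, so it does not isolate p: some ψ in p fails at
    -- a tuple satisfying it. The quantified witnesses of the projection extend that tuple to a
    -- naming for Γ.
    omit-at : ∀ v {Γ} → Consistent Γ → ∃[ ψ ] (p ψ × Consistent ((¬ᶠ ψ) at v ∷ Γ))
    omit-at v {Γ} (k , sat) with Allᵛ-bound v | Below-bound Γ | sat [] []
    ... | N₁ , bv | N₂ , bΓ | s , hΓ , _ with nonisolated (project (N₁ ⊔ N₂) v Γ)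
            (map s v , project⁺ (N₁ ⊔ N₂) M (Allᵛ.map (λ lt → ≤-trans lt (m≤n⇒m≤1+n (m≤m⊔n N₁ N₂))) bv)
                                (All.map (λ {f} → Below-mono {f = f} (m≤n⇒m≤1+n (m≤n⊔m N₁ N₂))) bΓ) s hΓ)
    ...   | ψ , pψ , ρ , hρ , ¬ψ with project⁻ (N₁ ⊔ N₂) M v Γ hρ
    ...     | s′ , refl , hΓ′ = ψ , pψ , tt ∷ k , λ { [] [] → s′ , ¬ψ ∷ hΓ′ , [] }
    omits-dense : ∀ f {Γ} → Consistent Γ → ∃[ Γ′ ] (Consistent Γ′ × Γ ⊑ Γ′ × Omits f Γ′)
    omits-dense f {Γ} ok with dec (∃[ v ] f ≡ (⊥ᶠ {n = n}) at v)
    ... | no ¬v = Γ , ok , id , λ v eq → contradiction (v , eq) ¬v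
    ... | yes (v , refl) with omit-at v ok
    ...   | ψ , pψ , ok′ = _ , ok′ , there , λ { _ refl → ψ , pψ , here refl }
    open Generic (vacuously M m) Omits omits-dense
    omitted : ∀ ρ → ∃[ ψ ] (p ψ × ¬ (model ⊨ ψ [ ρ ]))
    omitted ρ with extra (⊥ᶠ at map proj₁ ρ)
    ... | i , omits with omits (map proj₁ ρ) refl
    ...   | ψ , pψ , ¬ψ∈ = ψ , pψ , subst (λ η → ¬ (model ⊨ ψ [ η ])) (named ρ)
                                        (⇐ (truth {φ = ¬ᶠ ψ} tt (map proj₁ ρ)) (i , ¬ψ∈))

  -- Agreeing on a finite list of predicates replaces every count of classes: no cardinalities appear.

  Agree : ∀ {b} {B : Set b} → List (B → Set) → B → B → Set (b ⊔ᴸ lsuc 0ℓ)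
  Agree Qs x y = All (λ Q → Q x ⇔ Q y) Qs

  -- S is split along one predicate after another, and each inhabited cell contributes one element.
  -- `search` is a parameter because B is a small type for formulas and tuples but a large one for
  -- maximal types.
  representatives : ∀ {b} {B : Set b} → ((S : B → Set) → Dec (Σ B S)) →
                    (Qs : List (B → Set)) (S : B → Set) →
                    ∃[ xs ] (∀ x → S x → ∃[ y ] (y ∈ˡ xs × S y × Agree Qs x y))
  representatives search [] S with search S
  ... | yes (y , Sy) = y ∷ [] , λ x Sx → y , here refl , Sy , []
  ... | no none      = [] , λ x Sx → contradiction (x , Sx) none
  representatives search (Q ∷ Qs) S
    with representatives search Qs (λ x → S x × Q x) | representatives search Qs (λ x → S x × ¬ Q x)
  ... | xs , f | ys , g = xs ++ˡ ys , choose
    where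
    choose : ∀ x → S x → ∃[ y ] (y ∈ˡ xs ++ˡ ys × S y × Agree (Q ∷ Qs) x y)
    choose x Sx with dec (Q x)
    ... | yes Qx with f x (Sx , Qx)
    ...   | y , y∈ , (Sy , Qy) , agree = y , ∈-++⁺ˡ y∈ , Sy , mk⇔ (λ _ → Qy) (λ _ → Qx) ∷ agree
    choose x Sx | no ¬Qx with g x (Sx , ¬Qx)
    ...   | y , y∈ , (Sy , ¬Qy) , agree = y , ∈-++⁺ʳ xs y∈ , Sy
              , mk⇔ (λ Qx → contradiction Qx ¬Qx) (λ Qy → contradiction Qy ¬Qy) ∷ agree

  finitelyMany : ∀ {b ℓ} (S : Setoid b ℓ) → ((P : Setoid.Carrier S → Set) → Dec (Σ _ P)) →
                 (Qs : List (Setoid.Carrier S → Set)) →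
                 (∀ {x y} → Agree Qs x y → Setoid._≈_ S x y) → FinitelyMany S
  finitelyMany S search Qs separate with representatives search Qs (λ _ → ⊤)
  ... | xs , rep = xs , λ x → let y , y∈ , _ , agree = rep x tt in
                              Any.map (λ { refl → separate agree }) y∈

  -- Finitely many pp-formulas up to equivalence on a set of tuples

  module _ (A : Structure τ) {n : ℕ} where

    -- Expressed through separating predicates, finiteness passes to a union by concatenation, so
    -- one half of an infinite set is infinite again.
    Finite-on : (Vec (Carrier A) n → Set) → Set₁
    Finite-on X = ∃[ Qs ] (∀ (φ ψ : PPFormula τ n) → Agree Qs φ ψ →
                           ∀ a → X a → A ⊨ proj₁ φ [ a ] ⇔ A ⊨ proj₁ ψ [ a ])

    finite-on-list : ∀ as → Finite-on (_∈ˡ as)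
    finite-on-list as = List.map (λ a φ → A ⊨ proj₁ φ [ a ]) as ,
      λ φ ψ agree a a∈ → All.lookup (All.map⁻ agree) a∈

    finite-on-⊎ : ∀ {X Y : Vec (Carrier A) n → Set} →
                  Finite-on X → Finite-on Y → Finite-on (λ a → X a ⊎ Y a)
    finite-on-⊎ (Qs , f) (Qs′ , g) = Qs ++ˡ Qs′ , λ where
      φ ψ agree a (inj₁ x) → f φ ψ (All.++⁻ˡ Qs agree) a x
      φ ψ agree a (inj₂ y) → g φ ψ (All.++⁻ʳ Qs agree) a y

    finite-on-⊆ : ∀ {X Y : Vec (Carrier A) n → Set} → (∀ a → X a → Y a) → Finite-on Y → Finite-on X
    finite-on-⊆ X⊆Y (Qs , f) = Qs , λ φ ψ agree a x → f φ ψ agree a (X⊆Y a x)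

  tuples : {X : Set} → List X → ∀ n → List (Vec X n)
  tuples xs zero    = [] ∷ []
  tuples xs (suc n) = List.cartesianProductWith _∷_ xs (tuples xs n)

  ∈-tuples : {X : Set} {xs : List X} → (∀ x → x ∈ˡ xs) → ∀ {n} (v : Vec X n) → v ∈ˡ tuples xs n
  ∈-tuples all []      = here refl
  ∈-tuples all (x ∷ v) = ∈-cartesianProductWith⁺ _∷_ (all x) (∈-tuples all v)

  finite⇒finite-on : (A : Structure τ) → Finite (Carrier A) → ∀ n → Finite-on A {n} (λ _ → ⊤)
  finite⇒finite-on A (k , bij) n =
    finite-on-⊆ A (λ a _ → ∈-tuples listed a) (finite-on-list A (tuples (List.tabulate to) n))
    where
    open Inverse bij using (to; from; strictlyInverseˡ)
    listed : ∀ x → x ∈ˡ List.tabulate to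
    listed x = subst (_∈ˡ List.tabulate to) (strictlyInverseˡ x) (∈-tabulate⁺ (from x))

  -- If infinitely many pp-formulas are inequivalent over A, then halving the set of tuples along
  -- every formula, always keeping a half on which infinitely many remain inequivalent, yields a
  -- complete type that no formula isolates.  One countable model of Th A realises it, another omits it.

  module _ (A : Structure τ) (a₀ : Carrier A) (n : ℕ) (infinite : ¬ Finite-on A {n} (λ _ → ⊤)) where

    Infinite : List (Formula τ n) → Set₁
    Infinite Θ = ¬ Finite-on A {n} (λ a → All (λ θ → A ⊨ θ [ a ]) Θ)

    halve : ∀ ψ {Θ} → Infinite Θ → Infinite (ψ ∷ Θ) ⊎ Infinite (¬ᶠ ψ ∷ Θ)
    halve ψ {Θ} inf with em {Finite-on A {n} (λ a → All (λ θ → A ⊨ θ [ a ]) (ψ ∷ Θ))}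
    ... | no inf′ = inj₁ inf′
    ... | yes fin = inj₂ λ fin′ → inf (finite-on-⊆ A split (finite-on-⊎ A fin fin′))
      where
      split : ∀ a → All (λ θ → A ⊨ θ [ a ]) Θ →
              All (λ θ → A ⊨ θ [ a ]) (ψ ∷ Θ) ⊎ All (λ θ → A ⊨ θ [ a ]) (¬ᶠ ψ ∷ Θ)
      split a hs with dec (A ⊨ ψ [ a ])
      ... | yes h = inj₁ (h ∷ hs)
      ... | no ¬h = inj₂ (¬h ∷ hs)

    Branch : Set₁
    Branch = ∃ Infinite

    refine : ∀ ψ (b : Branch) → Σ Branch λ b′ → (∀ {θ} → θ ∈ˡ proj₁ b → θ ∈ˡ proj₁ b′) ×
                                                (ψ ∈ˡ proj₁ b′ ⊎ ¬ᶠ ψ ∈ˡ proj₁ b′)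
    refine ψ (Θ , inf) with halve ψ inf
    ... | inj₁ inf′ = (_ , inf′) , there , inj₁ (here refl)
    ... | inj₂ inf′ = (_ , inf′) , there , inj₂ (here refl)

    private
      module Branches = Chain {S = Branch} (λ b b′ → ∀ {θ} → θ ∈ˡ proj₁ b → θ ∈ˡ proj₁ b′) id (λ f g → g ∘ f)
        (formulas n) (λ ψ b → ψ ∈ˡ proj₁ b ⊎ ¬ᶠ ψ ∈ˡ proj₁ b) refine
        ([] , λ fin → infinite (finite-on-⊆ A (λ _ _ → []) fin))

    opaque
      branch : ℕ → List (Formula τ n)
      branch i = proj₁ (Branches.chain i)

      branch-infinite : ∀ i → Infinite (branch i)
      branch-infinite i = proj₂ (Branches.chain i)

      branch-mono : ∀ {i j} → i ≤ j → ∀ {θ} → θ ∈ˡ branch i → θ ∈ˡ branch j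
      branch-mono i≤j = Branches.chain-mono i≤j

      branch-decides : ∀ ψ → ∃[ i ] (ψ ∈ˡ branch i ⊎ ¬ᶠ ψ ∈ˡ branch i)
      branch-decides ψ = Branches.chain-meets (∈-formulas ψ)

    limit : Pred (Formula τ n) 0ℓ
    limit ψ = ∃[ i ] ψ ∈ˡ branch i

    limit-complete : ∀ ψ → limit ψ ⊎ limit (¬ᶠ ψ)
    limit-complete ψ with branch-decides ψ
    ... | i , inj₁ h = inj₁ (i , h)
    ... | i , inj₂ h = inj₂ (i , h)

    limit-finitely-satisfied : ∀ Δ → All limit Δ → ∃[ a ] All (λ φ → A ⊨ φ [ a ]) Δ
    limit-finitely-satisfied Δ hs with gather-stages branch branch-mono hs
    -- On an empty set of tuples the empty list of predicates separates, so an infinite stage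
    -- contains a tuple.
    ... | i , Δ⊆ = stable λ none → branch-infinite i ([] , λ _ _ _ a h →
      ⊥-elim (none (a , All.map (All.lookup h) Δ⊆)))

    -- A formula φ isolating `limit` would belong to it, and every χ would hold at all tuples
    -- satisfying φ or at none of them, according to whether `limit` contains it.
    limit-nonisolated : ∀ φ → ∃[ a ] A ⊨ φ [ a ] →
                        ∃[ ψ ] (limit ψ × ∃[ b ] (A ⊨ φ [ b ] × ¬ (A ⊨ ψ [ b ])))
    limit-nonisolated φ (a , hφ) = stable λ isolated → absurd λ ψ lim b hb →
      stable λ ¬ψ → isolated (ψ , lim , b , hb , ¬ψ)
      where
      absurd : ¬ (∀ ψ → limit ψ → ∀ b → A ⊨ φ [ b ] → A ⊨ ψ [ b ])
      absurd isolates with limit-complete φ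
      ... | inj₂ lim = isolates (¬ᶠ φ) lim a hφ hφ
      -- The single predicate of belonging to `limit` then separates pp-formulas on the tuples of
      -- the stage that contains φ.
      ... | inj₁ (i , φ∈) = branch-infinite i (limit ∘ proj₁ ∷ [] , λ where
              χ χ′ (agree ∷ []) b hb → mk⇔
                (λ h → decided χ′ b (All.lookup hb φ∈) (⇒ agree (holds χ b (All.lookup hb φ∈) h)))
                (λ h → decided χ b (All.lookup hb φ∈) (⇐ agree (holds χ′ b (All.lookup hb φ∈) h))))
        where
        decided : ∀ χ b → A ⊨ φ [ b ] → limit (proj₁ χ) → A ⊨ proj₁ χ [ b ]
        decided χ b hb lim = isolates (proj₁ χ) lim b hb
        holds : ∀ χ b → A ⊨ φ [ b ] → A ⊨ proj₁ χ [ b ] → limit (proj₁ χ)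
        holds χ b hb h with limit-complete (proj₁ χ)
        ... | inj₁ lim = lim
        ... | inj₂ lim = contradiction h (isolates _ lim b hb)

    ¬ω-categorical : ¬ ω-Categorical A
    ¬ω-categorical (_ , categorical) with compactness A a₀ limit limit-finitely-satisfied
                                        | omitting-types A a₀ limit limit-nonisolated
    ... | B , cB , B≡A , ρ , realises | C , cC , C≡A , omits = omitted (omits (map to (map from ρ)))
      where
      A≅B : A ≅ B
      A≅B = categorical B cB (λ {σ} → B≡A {σ})
      A≅C : A ≅ C
      A≅C = categorical C cC (λ {σ} → C≡A {σ})
      open Inverse (_≅_.bijection A≅C) using (to)
      open Inverse (_≅_.bijection A≅B) using (from; strictlyInverseˡ) renaming (to to toᴮ)
      round-trip : map toᴮ (map from ρ) ≡ ρ
      round-trip = trans (sym (map-∘ toᴮ from ρ)) (trans (map-cong strictlyInverseˡ ρ) (map-id ρ))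
      omitted : ¬ (∃[ ψ ] (limit ψ × ¬ (C ⊨ ψ [ map to (map from ρ) ])))
      omitted (ψ , lim , ¬h) = ¬h (⇒ (⊨-≅ A≅C ψ (map from ρ)) (⇐ (⊨-≅ A≅B ψ (map from ρ))
        (subst (λ η → B ⊨ ψ [ η ]) (sym round-trip) (realises lim))))

  -- Back and forth

  -- χ holds throughout A exactly when Th A contains ¬∃x̄ ¬χ.
  universal-transfer : ∀ {A B : Structure τ} {n} (χ : Formula τ n) → B IsModelOf Th A →
                       (∀ a → A ⊨ χ [ a ]) → ∀ b → B ⊨ χ [ b ]
  universal-transfer {A} {B} {n} χ B≡A h b = stable λ ¬h →
    B≡A {¬ᶠ close n (¬ᶠ χ)} (λ k → let a , ¬χ = close⁻ A n k in ¬χ (h a)) (close⁺ B b ¬h)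

  Isolates : (A : Structure τ) {n : ℕ} → Formula τ n → Set
  Isolates A {n} θ = (φ : Formula τ n) → IsPP φ →
                     (∀ a → A ⊨ θ [ a ] → A ⊨ φ [ a ]) ⊎ (∀ a → A ⊨ θ [ a ] → ¬ (A ⊨ φ [ a ]))

  -- The list is finite so that one first-order sentence can say that every tuple satisfies some
  -- member of it; `covered` carries this sentence to B.
  Atomic : Structure τ → Set
  Atomic A = ∀ n → ∃[ θs ] (All (λ θ → IsPP θ × Isolates A {n} θ) θs ×
                            (∀ a → ∃[ θ ] (θ ∈ˡ θs × A ⊨ θ [ a ])))

  module BackAndForth {A B : Structure τ} (cA : Countable (Carrier A)) (cB : Countable (Carrier B))
                      (atomic : Atomic A) (B≡A : B IsModelOf Th A) where

    Pairs : ℕ → Set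
    Pairs = Vec (Carrier A × Carrier B)

    PPEquivalent : ∀ {n} → Pairs n → Set
    PPEquivalent {n} w = (φ : Formula τ n) → IsPP φ → A ⊨ φ [ map proj₁ w ] ⇔ B ⊨ φ [ map proj₂ w ]

    -- That θ implies φ, or implies its negation, is a universal sentence true in A and hence in B.
    -- So θ decides φ in the same way on both sides.
    matched : ∀ {n} {θ : Formula τ n} → Isolates A θ → (w : Pairs n) →
              A ⊨ θ [ map proj₁ w ] → B ⊨ θ [ map proj₂ w ] → PPEquivalent w
    matched {θ = θ} isolates w hA hB φ pp with isolates φ pp
    ... | inj₁ θ⇒φ = mk⇔
      (λ _ → stable λ ¬h → universal-transfer (¬ᶠ (θ ∧ᶠ ¬ᶠ φ)) (λ {σ} → B≡A {σ})
                             (λ a (h , ¬φ) → ¬φ (θ⇒φ a h)) _ (hB , ¬h))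
      (λ _ → θ⇒φ _ hA)
    ... | inj₂ θ⇒¬φ = mk⇔
      (λ h → contradiction h (θ⇒¬φ _ hA))
      (λ h → ⊥-elim (universal-transfer (¬ᶠ (θ ∧ᶠ φ)) (λ {σ} → B≡A {σ})
                       (λ a (h , h′) → θ⇒¬φ a h h′) _ (hB , h)))

    covered : ∀ {n} (b : Vec (Carrier B) n) → ∃[ θ ] (θ ∈ˡ proj₁ (atomic n) × B ⊨ θ [ b ])
    covered {n} b = stable λ none →
      -- Disjunction is expressed as the negation of a conjunction of negations, with ¬⊥ as the
      -- empty conjunction.
      universal-transfer (¬ᶠ conj (¬ᶠ ⊥ᶠ) (List.map ¬ᶠ_ θs)) (λ {σ} → B≡A {σ}) somewhere b
        (conj⁺ B id (All.map⁺ (All.tabulate (λ θ∈ h → none (_ , θ∈ , h)))))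
      where
      θs : List (Formula τ n)
      θs = proj₁ (atomic n)
      somewhere : ∀ a → ¬ (A ⊨ conj (¬ᶠ ⊥ᶠ) (List.map ¬ᶠ_ θs) [ a ])
      somewhere a h with proj₂ (proj₂ (atomic n)) a
      ... | θ , θ∈ , hθ = All.lookup (All.map⁻ (proj₂ (conj⁻ A (List.map ¬ᶠ_ θs) h))) θ∈ hθ

    State : Set
    State = ∃[ n ] Σ (Pairs n) PPEquivalent

    infix 4 _∈ˢ_
    _∈ˢ_ : Carrier A × Carrier B → State → Set
    x ∈ˢ (n , w , _) = ∃[ j ] lookup w j ≡ x

    -- The formula θ isolating the lengthened tuple is pp, hence so is ∃θ, and the pp-equivalence
    -- already reached moves it to the other structure. In `back`, θ comes from `covered`.
    forth : ∀ a (s : State) → ∃[ t ] ((∀ x → x ∈ˢ s → x ∈ˢ t) × ∃[ b ] (a , b) ∈ˢ t)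
    forth a (n , w , e) with proj₂ (proj₂ (atomic (suc n))) (a ∷ map proj₁ w)
    ... | θ , θ∈ , h with All.lookup (proj₁ (proj₂ (atomic (suc n)))) θ∈
    ...   | pp , isolates with ⇒ (e (∃ᶠ θ) (∃ᶠ pp)) (a , h)
    ...     | b , h′ = (suc n , (a , b) ∷ w , matched {θ = θ} isolates ((a , b) ∷ w) h h′)
                     , (λ { x (j , eq) → suc j , eq }) , b , zero , refl

    back : ∀ b (s : State) → ∃[ t ] ((∀ x → x ∈ˢ s → x ∈ˢ t) × ∃[ a ] (a , b) ∈ˢ t)
    back b (n , w , e) with covered (b ∷ map proj₂ w)
    ... | θ , θ∈ , h with All.lookup (proj₁ (proj₂ (atomic (suc n)))) θ∈
    ...   | pp , isolates with ⇐ (e (∃ᶠ θ) (∃ᶠ pp)) (b , h)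
    ...     | a , h′ = (suc n , (a , b) ∷ w , matched {θ = θ} isolates ((a , b) ∷ w) h′ h)
                     , (λ { x (j , eq) → suc j , eq }) , a , zero , refl

    Reaches : Carrier A ⊎ Carrier B → State → Set
    Reaches (inj₁ a) s = ∃[ b ] (a , b) ∈ˢ s
    Reaches (inj₂ b) s = ∃[ a ] (a , b) ∈ˢ s

    reach : ∀ r (s : State) → ∃[ t ] ((∀ x → x ∈ˢ s → x ∈ˢ t) × Reaches r t)
    reach (inj₁ a) = forth a
    reach (inj₂ b) = back b

    elements : Enumeration (Carrier A ⊎ Carrier B)
    elements = (enumerate cA ⊗ λ a → pure (inj₁ a)) ⊕ (enumerate cB ⊗ λ b → pure (inj₂ b))

    ∈-elements : ∀ r → r ∈ᵉ elements
    ∈-elements (inj₁ a) = ∈-⊕ˡ (∈-⊗ (∈-enumerate cA a) ∈-pure)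
    ∈-elements (inj₂ b) = ∈-⊕ʳ (∈-⊗ (∈-enumerate cB b) ∈-pure)

    initial : State
    initial = 0 , [] , λ φ pp → mk⇔ (B≡A {φ}) (λ h → stable λ ¬h → B≡A {¬ᶠ φ} ¬h h)

    private
      module States = Chain {S = State} (λ s t → ∀ x → x ∈ˢ s → x ∈ˢ t) (λ _ → id) (λ f g x → g x ∘ f x)
                            elements Reaches reach initial

    opaque
      state : ℕ → State
      state = States.chain

      state-mono : ∀ {i j} → i ≤ j → ∀ x → x ∈ˢ state i → x ∈ˢ state j
      state-mono = States.chain-mono

      state-reaches : ∀ r → ∃[ i ] Reaches r (state i)
      state-reaches r = States.chain-meets (∈-elements r)

    Related : Carrier A × Carrier B → Set
    Related x = ∃[ i ] x ∈ˢ state i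

    positions : ∀ {m} {w : Pairs m} → Allᵛ Related w →
                ∃[ i ] ∃[ js ] map (lookup (proj₁ (proj₂ (state i)))) js ≡ w
    positions hs with at-stage hs
      where
      at-stage : ∀ {m} {w : Pairs m} → Allᵛ Related w → ∃[ i ] Allᵛ (_∈ˢ state i) w
      at-stage [] = 0 , []
      at-stage ((i , x∈) ∷ hs) with at-stage hs
      ... | j , h = i ⊔ j , state-mono (m≤m⊔n i j) _ x∈ ∷ Allᵛ.map (state-mono (m≤n⊔m i j) _) h
    ... | i , h = i , indices h
      where
      indices : ∀ {m} {w : Pairs m} → Allᵛ (_∈ˢ state i) w → ∃[ js ] map (lookup (proj₁ (proj₂ (state i)))) js ≡ w
      indices [] = [] , refl
      indices ((j , refl) ∷ h) with indices h
      ... | js , refl = j ∷ js , refl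

    -- Finitely many related pairs occur together at one stage. Picking them out of its tuple is a
    -- renaming of variables, which keeps formulas pp.
    preserved : ∀ {m} {w : Pairs m} → Allᵛ Related w → PPEquivalent w
    preserved hs φ pp with positions hs
    ... | i , js , refl with state i
    ...   | n , w , e = mk⇔
      (λ h → subst (λ ρ → B ⊨ φ [ ρ ]) (project-map proj₂)
               (⇒ (⊨-rename B js φ _) (⇒ (e _ (rename-pp js pp))
                 (⇐ (⊨-rename A js φ _) (subst (λ ρ → A ⊨ φ [ ρ ]) (sym (project-map proj₁)) h)))))
      (λ h → subst (λ ρ → A ⊨ φ [ ρ ]) (project-map proj₁)
               (⇒ (⊨-rename A js φ _) (⇐ (e _ (rename-pp js pp))
                 (⇐ (⊨-rename B js φ _) (subst (λ ρ → B ⊨ φ [ ρ ]) (sym (project-map proj₂)) h)))))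
      where
      project-map : ∀ {X : Set} (f : Carrier A × Carrier B → X) →
                    map (lookup (map f w)) js ≡ map f (map (lookup w) js)
      project-map f = trans (map-cong (λ j → lookup-map j f w) js) (map-∘ f (lookup w) js)

    to : Carrier A → Carrier B
    to a = proj₁ (proj₂ (state-reaches (inj₁ a)))

    from : Carrier B → Carrier A
    from b = proj₁ (proj₂ (state-reaches (inj₂ b)))

    related-to : ∀ a → Related (a , to a)
    related-to a with state-reaches (inj₁ a)
    ... | i , b , r = i , r

    related-from : ∀ b → Related (from b , b)
    related-from b with state-reaches (inj₂ b)
    ... | i , a , r = i , r

    -- Equality is itself a pp-formula, so `Related` is single-valued in both directions; this makes
    -- `to` and `from` mutually inverse although they were chosen independently.
    same⇔same : ∀ {a a′ b b′} → Related (a , b) → Related (a′ , b′) → (a ≡ a′) ⇔ (b ≡ b′)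
    same⇔same r r′ = preserved (r ∷ r′ ∷ []) (var zero ≈ᶠ var (suc zero)) (_ ≈ᶠ _)

    isomorphic : A ≅ B
    isomorphic = record
      { bijection = mk↔ₛ′ to from
          (λ b → ⇒ (same⇔same (related-to (from b)) (related-from b)) refl)
          (λ a → ⇐ (same⇔same (related-from (to a)) (related-to a)) refl)
      ; rel-iff   = λ R as → let e = preserved (graph as) (rel R (map var (allFin _))) (rel R _) in mk⇔
          (λ h → subst (relᴬ B R) (argsᴮ as) (⇒ e (subst (relᴬ A R) (sym (argsᴬ as)) h)))
          (λ h → subst (relᴬ A R) (argsᴬ as) (⇐ e (subst (relᴬ B R) (sym (argsᴮ as)) h)))
      ; con-≡     = λ c → ⇒ (preserved (related-to (conᴬ A c) ∷ []) (var zero ≈ᶠ con c) (_ ≈ᶠ _)) refl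
      }
      where
      pair : Carrier A → Carrier A × Carrier B
      pair a = a , to a
      graph : ∀ {m} (as : Vec (Carrier A) m) → Allᵛ Related (map pair as)
      graph []       = []
      graph (a ∷ as) = related-to a ∷ graph as
      argsᴬ : ∀ {m} (as : Vec (Carrier A) m) →
              map (λ t → ⟦ t ⟧ A (map proj₁ (map pair as))) (map var (allFin _)) ≡ as
      argsᴬ as = trans (⟦vars⟧ A _) (trans (sym (map-∘ proj₁ pair as)) (map-id as))
      argsᴮ : ∀ {m} (as : Vec (Carrier A) m) →
              map (λ t → ⟦ t ⟧ B (map proj₂ (map pair as))) (map var (allFin _)) ≡ map to as
      argsᴮ as = trans (⟦vars⟧ B _) (sym (map-∘ proj₂ pair as))

  -- Complete pp-theories

  module Theory (T : Pred (Sentence τ) 0ℓ) (completeT : IsCompletePPTheory T) where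
    open IsCompletePPTheory completeT

    Together : ∀ {n} → Formula τ n → Formula τ n → Set₁
    Together {n} φ ψ = Satisfiable (｛ φ ｝ ∪ ｛ ψ ｝ ∪ T ⟨ n ⟩)

    model-of-weakened : ∀ {A : Structure τ} {n} {ρ : Vec (Carrier A) n} →
                        (∀ {φ} → (T ⟨ n ⟩) φ → A ⊨ φ [ ρ ]) → A IsModelOf T
    model-of-weakened {A} {ρ = ρ} h {σ} σ∈ = ⇒ (⊨-weaken A σ [] ρ) (h (σ , σ∈ , refl))

    weakened-holds : ∀ {A : Structure τ} → A IsModelOf T → ∀ {n} (ρ : Vec (Carrier A) n) {φ} →
                     (T ⟨ n ⟩) φ → A ⊨ φ [ ρ ]
    weakened-holds {A} A⊨T ρ (σ , σ∈ , refl) = ⇐ (⊨-weaken A σ [] ρ) (A⊨T σ∈)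

    -- The existential closure of a pp-formula is a pp-sentence, so T decides it.
    pp-transfer : ∀ {A B : Structure τ} → A IsModelOf T → B IsModelOf T →
                  ∀ {n} {φ : Formula τ n} → IsPP φ → ∀ {ρ} → A ⊨ φ [ ρ ] → ∃[ η ] B ⊨ φ [ η ]
    pp-transfer {A} {B} A⊨T B⊨T {n} {φ} pp {ρ} h with complete (close n φ) (close-pp n pp)
    ... | inj₁ ∈T  = close⁻ B n (B⊨T ∈T)
    ... | inj₂ ¬∈T = contradiction (close⁺ A ρ h) (A⊨T ¬∈T)

    together⁺ : ∀ {A : Structure τ} → A IsModelOf T → ∀ {n} {φ ψ : Formula τ n} {ρ} →
                A ⊨ φ [ ρ ] → A ⊨ ψ [ ρ ] → Together φ ψ
    together⁺ {A} A⊨T {ρ = ρ} hφ hψ = A , ρ , λ where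
      (inj₁ refl)        → hφ
      (inj₂ (inj₁ refl)) → hψ
      (inj₂ (inj₂ t))    → weakened-holds {A} A⊨T ρ t

    together⁻ : ∀ {A : Structure τ} → A IsModelOf T → ∀ {n} {φ ψ : Formula τ n} → IsPP φ → IsPP ψ →
                Together φ ψ → ∃[ ρ ] (A ⊨ φ [ ρ ] × A ⊨ ψ [ ρ ])
    together⁻ {A} A⊨T ppφ ppψ (B , ρ , h) =
      pp-transfer {B} {A} (model-of-weakened {B} {ρ = ρ} (λ t → h (inj₂ (inj₂ t)))) A⊨T (ppφ ∧ᶠ ppψ)
                  (h (inj₁ refl) , h (inj₂ (inj₁ refl)))

    -- Every pp-formula that fails at a tuple is excluded, modulo T, by one that holds there.
    PPClosed : Structure τ → Set₁
    PPClosed A = ∀ {n} (φ : Formula τ n) → IsPP φ → ∀ a →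
                 A ⊨ φ [ a ] ⊎ (∃[ ψ ] (IsPP ψ × A ⊨ ψ [ a ] × ¬ Together φ ψ))

    -- What a generic set of pp-instances rejects is refuted in M by finitely many of its members.
    -- Their projection to the rejected tuple is the excluding formula: incompatibility in M is
    -- incompatibility modulo T.
    pp-closed-model : ∀ {M : Structure τ} → M IsModelOf T → Carrier M →
                      Σ (Structure τ) λ A → A IsModelOf T × Carrier A × Countable (Carrier A) × PPClosed A
    pp-closed-model {M} M⊨T m = model , models , class 0 , countable , closed
      where
      open Henkin M IsPP pp-fragment (λ _ → ⊥) 0 (λ ())
      open Generic (vacuously M m) (λ _ _ → ⊤) (λ f ok → _ , ok , id , tt)
      models : model IsModelOf T
      -- The generic model and M satisfy the same pp-sentences; positive members of T use one
      -- direction, negated members the other.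
      models {φ} φ∈ with members φ∈
      ... | inj₁ pp = elementary {φ} pp (M⊨T φ∈)
      ... | inj₂ (ψ , pp , refl) = λ h → M⊨T φ∈ (reflects {ψ} pp h)
      closed-at : ∀ {n} (φ : Formula τ n) → IsPP φ → ∀ v → model ⊨ φ [ map class v ] ⊎
                  (∃[ ψ ] (IsPP ψ × model ⊨ ψ [ map class v ] × ¬ Together φ ψ))
      closed-at φ pp v with decided (φ at v) pp
      ... | inj₁ g = inj₁ (⇐ (truth pp v) g)
      -- P is empty, so the refutation rests on Γ alone.
      ... | inj₂ (Γ , [] , gs , [] , excluded) with Allᵛ-bound v | Below-bound Γ
      ...   | N₁ , bv | N₂ , bΓ = inj₂ (project N v Γ , ppψ , holds , incompatible)
        where
        N : ℕ
        N = N₁ ⊔ N₂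
        all-pp : ∀ {Δ} → All (InFragment IsPP) Δ → All PP Δ
        all-pp = All.map λ { {_ at _} p → p }
        ppψ : IsPP (project N v Γ)
        ppψ = project-pp N v (all-pp (G⊆K gs))
        holds : model ⊨ project N v Γ [ map class v ]
        holds = project⁺ N model (Allᵛ.map (λ lt → ≤-trans lt (m≤n⇒m≤1+n (m≤m⊔n N₁ N₂))) bv)
          (All.map (λ {f} → Below-mono {f = f} (m≤n⇒m≤1+n (m≤n⊔m N₁ N₂))) bΓ) class
          (All.zipWith (λ { {_ at u} (p , g) → ⇐ (truth p u) g }) (G⊆K gs , gs))
        incompatible : ¬ Together φ (project N v Γ)
        incompatible sat with together⁻ {M} M⊨T pp ppψ sat
        ... | ρ , hφ , hψ with project⁻ N M v Γ hψ
        ...   | s , refl , hΓ = excluded s hΓ [] hφ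
      closed : PPClosed model
      closed φ pp a = subst (λ ρ → model ⊨ φ [ ρ ] ⊎ (∃[ ψ ] (IsPP ψ × model ⊨ ψ [ ρ ] × ¬ Together φ ψ)))
                            (named a) (closed-at φ pp (map proj₁ a))

    -- Finite index and models of T

    finite-on⇒finite-index : ∀ {A : Structure τ} → A IsModelOf T →
                             ∀ {n} → Finite-on A {n} (λ _ → ⊤) → FinitelyMany (∼-setoid T n)
    finite-on⇒finite-index {A} A⊨T {n} (Qs , separates) =
      finitelyMany (∼-setoid T n) (λ P → dec _) Qs λ {φ} {φ′} agree ψ pp → mk⇔
        (replace φ φ′ (λ a → ⇒ (separates φ φ′ agree a tt)) ψ pp)
        (replace φ′ φ (λ a → ⇐ (separates φ φ′ agree a tt)) ψ pp)
      where
      replace : ∀ (φ φ′ : PPFormula τ n) → (∀ a → A ⊨ proj₁ φ [ a ] → A ⊨ proj₁ φ′ [ a ]) →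
                ∀ ψ → IsPP ψ → Together (proj₁ φ) ψ → Together (proj₁ φ′) ψ
      -- Joint satisfiability modulo T is tested in A, where only the tuples satisfying φ and ψ
      -- matter.
      replace (φ , ppφ) (φ′ , _) φ⇒φ′ ψ ppψ sat with together⁻ {A} A⊨T ppφ ppψ sat
      ... | a , hφ , hψ = together⁺ {A} A⊨T (φ⇒φ′ a hφ) hψ

    finite-or-ω-categorical⇒finite-index : HasFiniteOrω-CategoricalModel T → FiniteIndex T
    finite-or-ω-categorical⇒finite-index (A , A⊨T , inj₁ fin) n =
      finite-on⇒finite-index {A} A⊨T (finite⇒finite-on A fin n)
    finite-or-ω-categorical⇒finite-index (A , A⊨T , inj₂ ω) n =
      finite-on⇒finite-index {A} A⊨T (decidable-stable em λ infinite →
        ¬ω-categorical A (Inverse.to (proj₁ ω) 0) n infinite ω)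

    module _ {A : Structure τ} (A⊨T : A IsModelOf T) (a₀ : Carrier A) (closed : PPClosed A)
             (index : FiniteIndex T) where

      -- If φ′ failed at a, the formula ψ excluding it would hold at a, hence be compatible with φ
      -- but not with φ′.
      respects-∼ : ∀ {n} (φ φ′ : PPFormula τ n) → _∼_ T φ φ′ →
                   ∀ {a} → A ⊨ proj₁ φ [ a ] → A ⊨ proj₁ φ′ [ a ]
      respects-∼ (φ , _) (φ′ , pp′) φ∼φ′ {a} h with closed φ′ pp′ a
      ... | inj₁ h′ = h′
      ... | inj₂ (ψ , ppψ , hψ , excluded) = contradiction (⇒ (φ∼φ′ ψ ppψ) (together⁺ {A} A⊨T h hψ)) excluded

      module _ (n : ℕ) where

        classes : List (PPFormula τ n)
        classes = proj₁ (index n)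

        Satisfied : Vec (Carrier A) n → PPFormula τ n → Set
        Satisfied a φ = A ⊨ proj₁ φ [ a ]

        -- The empty conjunction: pp-formulas have no symbol for truth, and for n = 0 there may be
        -- no term to equate with itself. The element a₀ makes it true.
        nonempty : Formula τ n
        nonempty = ∃ᶠ (var zero ≈ᶠ var zero)

        satisfied : Vec (Carrier A) n → List (PPFormula τ n)
        satisfied a = List.filter (λ φ → dec (Satisfied a φ)) classes

        -- Only what holds at a is recorded. If φ fails at a, closedness supplies a formula that
        -- holds there and excludes φ, and the diagram implies that formula.
        diagram : Vec (Carrier A) n → Formula τ n
        diagram a = conj nonempty (List.map proj₁ (satisfied a))

        diagram-pp : ∀ a → IsPP (diagram a)
        diagram-pp a = conj-pp (∃ᶠ (_ ≈ᶠ _)) (All.map⁺ (All.universal {P = IsPP ∘ proj₁} proj₂ (satisfied a)))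

        diagram-holds : ∀ {a b} → (∀ φ → φ ∈ˡ classes → Satisfied a φ → Satisfied b φ) → A ⊨ diagram a [ b ]
        diagram-holds {a} h = conj⁺ A (a₀ , refl) (All.map⁺ (All.tabulate λ {φ} φ∈ →
          let φ∈classes , hφ = ∈-filter⁻ (λ φ → dec (Satisfied a φ)) φ∈ in h φ φ∈classes hφ))

        diagram⇒ : ∀ {a b} → A ⊨ diagram a [ b ] →
                   ∀ (φ : PPFormula τ n) → Satisfied a φ → Satisfied b φ
        diagram⇒ {a} {b} h φ hφ with find (proj₂ (index n) φ)
        ... | φ′ , φ′∈ , φ∼φ′ = respects-∼ φ′ φ (λ ψ pp → mk⇔ (⇐ (φ∼φ′ ψ pp)) (⇒ (φ∼φ′ ψ pp)))
          (All.lookup (All.map⁻ (proj₂ (conj⁻ A (List.map proj₁ (satisfied a)) h)))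
                      (∈-filter⁺ (λ φ → dec (Satisfied a φ)) φ′∈ (respects-∼ φ φ′ φ∼φ′ hφ)))

        diagram-isolates : ∀ a → Isolates A (diagram a)
        diagram-isolates a φ pp with closed φ pp a
        ... | inj₁ h = inj₁ λ b hb → diagram⇒ hb (φ , pp) h
        ... | inj₂ (ψ , ppψ , hψ , excluded) = inj₂ λ b hb hφ →
          excluded (together⁺ {A} A⊨T hφ (diagram⇒ hb (ψ , ppψ) hψ))

      atomic : Atomic A
      atomic n with representatives (λ P → dec _) (List.map (λ φ a → Satisfied n a φ) (classes n)) (λ _ → ⊤)
      ... | as , rep = List.map (diagram n) as
                     , All.map⁺ (All.universal (λ a → diagram-pp n a , diagram-isolates n a) as)
                     , λ a → let b , b∈ , _ , agree = rep a tt in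
                         diagram n b , ∈-map⁺ (diagram n) b∈
                         , diagram-holds n (λ φ φ∈ → ⇐ (All.lookup (All.map⁻ agree) φ∈))

    empty-model : ∀ {M : Structure τ} → M IsModelOf T → ¬ Carrier M → HasFiniteOrω-CategoricalModel T
    empty-model {M} M⊨T none = M , M⊨T , inj₁ (0 , mk↔ₛ′ (λ ()) (λ m → contradiction m none)
                                                        (λ m → contradiction m none) (λ ()))

    finite-index⇒finite-or-ω-categorical : FiniteIndex T → HasFiniteOrω-CategoricalModel T
    finite-index⇒finite-or-ω-categorical index with satisfiable
    ... | M , [] , M⊨T with dec (Carrier M)
    ...   | no none = empty-model {M} M⊨T none
    ...   | yes m with pp-closed-model {M} M⊨T m
    ...     | A , A⊨T , a₀ , cA , closed = A , A⊨T , Sum.map₂ (λ infinite → infinite , λ B cB B≡A →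
                BackAndForth.isomorphic cA cB (atomic {A} A⊨T a₀ closed index) (λ {σ} → B≡A {σ}))
                (finite-or-infinite cA)

    -- Maximal pp-types

    module _ {n : ℕ} (p : MaximalPPType T n) where

      Member : Formula τ n → Set
      Member = T ⟨ n ⟩ ∪ proj₁ p

      open IsMaximalPPType (proj₂ p)
      open IsPPType isPPType

      -- For finite Θ in p, φ is compatible with φ ∧ ⋀Θ, hence so is φ′. Thus p with φ′ is finitely
      -- satisfiable in C, and compactness contradicts maximality if φ′ is missing.
      member-respects-∼ : ∀ (φ φ′ : PPFormula τ n) → _∼_ T φ φ′ → Member (proj₁ φ) → Member (proj₁ φ′)
      member-respects-∼ (φ , ppφ) (φ′ , pp′) φ∼φ′ φ∈ = stable λ φ′∉ → maximal φ′ pp′ φ′∉ extended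
        where
        C : Structure τ
        C = proj₁ consistent
        ρ : Vec (Carrier C) n
        ρ = proj₁ (proj₂ consistent)
        C⊨T : C IsModelOf T
        C⊨T = model-of-weakened {C} {ρ = ρ} (λ t → proj₂ (proj₂ consistent) (inj₂ t))
        hφ : C ⊨ φ [ ρ ]
        hφ = [ (λ t → proj₂ (proj₂ consistent) (inj₂ t)) , (λ q → proj₂ (proj₂ consistent) (inj₁ q)) ]′ φ∈
        p⁺ : Pred (Formula τ n) 0ℓ
        p⁺ χ = proj₁ p χ ⊎ φ′ ≡ χ
        part : ∀ {Δ} → All p⁺ Δ → ∃[ Θ ] (All (proj₁ p) Θ × (∀ {a} → C ⊨ φ′ [ a ] →
               All (λ χ → C ⊨ χ [ a ]) Θ → All (λ χ → C ⊨ χ [ a ]) Δ))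
        part [] = [] , [] , λ _ _ → []
        part (h ∷ hs) with part hs
        part (inj₁ q ∷ hs)    | Θ , qs , f = _ ∷ Θ , q ∷ qs , λ { h (k ∷ ks) → k ∷ f h ks }
        part (inj₂ refl ∷ hs) | Θ , qs , f = Θ , qs , λ h ks → h ∷ f h ks
        finitely : ∀ Δ → All p⁺ Δ → ∃[ a ] All (λ χ → C ⊨ χ [ a ]) Δ
        finitely Δ hs with part hs
        ... | Θ , qs , f with together⁻ {C} C⊨T pp′ (conj-pp ppφ (All.map pp qs))
                (⇒ (φ∼φ′ (conj φ Θ) (conj-pp ppφ (All.map pp qs))) (together⁺ {C} C⊨T hφ
                   (conj⁺ C hφ (All.map (λ q → proj₂ (proj₂ consistent) (inj₁ q)) qs))))
        ...   | a , hφ′ , hΘ = a , f hφ′ (proj₂ (conj⁻ C Θ hΘ))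
        satisfy : ∀ (B : Structure τ) → B IsModelOf T → ∃[ a ] (∀ {χ} → p⁺ χ → B ⊨ χ [ a ]) →
                  Satisfiable (T ⟨ n ⟩ ∪ proj₁ p ∪ ｛ φ′ ｝)
        satisfy B B⊨T (a , h) = B , a , [ weakened-holds {B} B⊨T a , h ]′
        extended : Satisfiable (T ⟨ n ⟩ ∪ proj₁ p ∪ ｛ φ′ ｝)
        extended with dec (Carrier C)
        ... | yes c with compactness C c p⁺ finitely
        ...   | B , _ , B≡C , realised = satisfy B (λ {σ} σ∈ → B≡C {σ} (C⊨T σ∈)) realised
        -- Compactness needs an element. An empty C has at most one n-tuple, so formulas satisfied
        -- one at a time are satisfied together.
        extended | no none = satisfy C C⊨T (proj₁ (finitely [] []) , λ {χ} h →
          subst (λ a → C ⊨ χ [ a ]) (unique _ _) (All.head (proj₂ (finitely (χ ∷ []) (h ∷ [])))))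
          where
          unique : ∀ {m} (u v : Vec (Carrier C) m) → u ≡ v
          unique [] [] = refl
          unique (x ∷ _) _ = contradiction x none

    finite-index⇒finitely-many-maximal-types : FiniteIndex T → FinitelyManyMaximalPPTypes T
    finite-index⇒finitely-many-maximal-types index n =
      finitelyMany (maximalPPTypes T n) (λ P → em) (List.map (λ φ p → Member p (proj₁ φ)) reps) λ {p} {q} agree →
        included p q (λ φ∈ → ⇒ (All.lookup (All.map⁻ agree) φ∈)) ,
        included q p (λ φ∈ → ⇐ (All.lookup (All.map⁻ agree) φ∈))
      where
      reps : List (PPFormula τ n)
      reps = proj₁ (index n)
      bundle : ∀ p {φ} → proj₁ p φ → PPFormula τ n
      bundle p φ∈ = _ , IsPPType.pp (IsMaximalPPType.isPPType (proj₂ p)) φ∈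
      included : ∀ p q → (∀ {φ} → φ ∈ˡ reps → Member p (proj₁ φ) → Member q (proj₁ φ)) →
                 ∀ {φ} → Member p φ → Member q φ
      included p q h (inj₁ t) = inj₁ t
      included p q h {φ} (inj₂ φ∈) with find (proj₂ (index n) (bundle p φ∈))
      ... | φ′ , φ′∈ , φ∼φ′ = member-respects-∼ q φ′ (bundle p φ∈) (λ ψ pp → mk⇔ (⇐ (φ∼φ′ ψ pp)) (⇒ (φ∼φ′ ψ pp)))
                                (h φ′∈ (member-respects-∼ p (bundle p φ∈) φ′ φ∼φ′ (inj₂ φ∈)))

    module _ {A : Structure τ} (A⊨T : A IsModelOf T) (closed : PPClosed A) {n : ℕ} where

      pp-type : Vec (Carrier A) n → Pred (Formula τ n) 0ℓ
      pp-type a φ = IsPP φ × A ⊨ φ [ a ]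

      -- The formula that excludes a missing φ holds at a and so belongs to the type.
      pp-type-maximal : ∀ a → IsMaximalPPType T (pp-type a)
      pp-type-maximal a = record
        { isPPType = record { pp = proj₁ ; consistent = A , a , [ proj₂ , weakened-holds {A} A⊨T a ]′ }
        ; maximal  = maximal
        }
        where
        maximal : ∀ φ → IsPP φ → ¬ (T ⟨ n ⟩ ∪ pp-type a) φ → ¬ Satisfiable (T ⟨ n ⟩ ∪ pp-type a ∪ ｛ φ ｝)
        maximal φ pp φ∉ (B , b , h) with closed φ pp a
        ... | inj₁ hφ = φ∉ (inj₂ (pp , hφ))
        ... | inj₂ (ψ , ppψ , hψ , excluded) = excluded (B , b , λ where
          (inj₁ refl)        → h (inj₂ (inj₂ refl))
          (inj₂ (inj₁ refl)) → h (inj₂ (inj₁ (ppψ , hψ)))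
          (inj₂ (inj₂ t))    → h (inj₁ t))

      -- Modulo T the pp-type of each tuple a is one of the listed types, and φ holds at a exactly
      -- when it belongs to that type. So membership in the listed types separates pp-formulas on
      -- all tuples of A.
      finitely-many-maximal-types⇒finite-index : FinitelyMany (maximalPPTypes T n) → FinitelyMany (∼-setoid T n)
      finitely-many-maximal-types⇒finite-index (ps , covers) =
        finite-on⇒finite-index {A} A⊨T (List.map (λ p φ → Member p (proj₁ φ)) ps , λ φ φ′ agree a _ →
          mk⇔ (replace a φ φ′ (λ p∈ → ⇒ (All.lookup (All.map⁻ agree) p∈)))
              (replace a φ′ φ (λ p∈ → ⇐ (All.lookup (All.map⁻ agree) p∈))))
        where
        replace : ∀ a (φ φ′ : PPFormula τ n) → (∀ {p} → p ∈ˡ ps → Member p (proj₁ φ) → Member p (proj₁ φ′)) →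
                  A ⊨ proj₁ φ [ a ] → A ⊨ proj₁ φ′ [ a ]
        replace a (φ , pp) (φ′ , _) h hφ with find (covers (pp-type a , pp-type-maximal a))
        ... | p , p∈ , type⊆p , p⊆type =
          [ weakened-holds {A} A⊨T a , proj₂ ]′ (p⊆type (h p∈ (type⊆p (inj₂ (pp , hφ)))))

    finitely-many-maximal-types⇒finite : FinitelyManyMaximalPPTypes T → FiniteIndex T
    finitely-many-maximal-types⇒finite types with satisfiable
    ... | M , [] , M⊨T with dec (Carrier M)
    ...   | no none = finite-or-ω-categorical⇒finite-index (empty-model {M} M⊨T none)
    ...   | yes m with pp-closed-model {M} M⊨T m
    ...     | A , A⊨T , _ , _ , closed = λ n → finitely-many-maximal-types⇒finite-index {A} A⊨T closed (types n)

    equivalences : (HasFiniteOrω-CategoricalModel T ⇔ FiniteIndex T) ×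
                   (FiniteIndex T ⇔ FinitelyManyMaximalPPTypes T)
    equivalences =
      mk⇔ finite-or-ω-categorical⇒finite-index finite-index⇒finite-or-ω-categorical ,
      mk⇔ finite-index⇒finitely-many-maximal-types finitely-many-maximal-types⇒finite

theorem3 : ExcludedMiddle (lsuc 0ℓ) →
           (τ : Signature) → Countable (Rel τ) → Countable (Const τ) →
           (T : Pred (Sentence τ) 0ℓ) → IsCompletePPTheory T →
           (HasFiniteOrω-CategoricalModel T ⇔ FiniteIndex T) ×
           (FiniteIndex T ⇔ FinitelyManyMaximalPPTypes T)
theorem3 em τ countableRel countableConst T completeT = Theory.equivalences T completeT
  where open Countably em τ countableRel countableConst
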